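{- Let $(E,\mathcal{I},g)$ be a CBGT instance such that $(E,\mathcal{I})$ is a matroid with family of independent sets $\mathcal{I}$. Then there exists an infinite valid schedule $\pi$ for $(E,\mathcal{I},g)$ with $h(\pi)<2$.
   Context: An instance of Combinatorial Bamboo Garden Trimming (CBGT) is a triple $(E,\mathcal{I},g)$ where $E$ is a finite set (of "bamboos"), $\mathcal{I}\subseteq 2^E$ is a family of subsets of $E$, and $g\in\mathbb{Q}_{\ge 0}^E$ is a vector of growth rates such that there are coefficients $\lambda(I)\ge 0$ ($I\in\mathcal{I}$) with $\sum_{I\in\mathcal{I}}\lambda(I)=1$ and $g(e)=\sum_{I\in\mathcal{I}:\, e\in I}\lambda(I)$ for every $e\in E$. Let $\mathbb{N}=\{1,2,\dots\}$. An infinite schedule is a sequence $\pi=\pi(1),\pi(2),\dots$ of subsets of $E$; it is valid if $\pi(t)\in\mathcal{I}$ for all $t\in\mathbb{N}$. All bamboos start at height $0$; on each day $t$ every bamboo $e$ first grows by $g(e)$, and then the bamboos in $\pi(t)$ are cut to height $0$. $h^\pi_t(e)$ denotes the height of $e$ on day $t$ after growing but before $\pi(t)$ is cut, i.e. $h^\pi_1(e)=g(e)$, and $h^\pi_{t+1}(e)=g(e)$ if $e\in\pi(t)$, $h^\pi_{t+1}(e)=h^\pi_t(e)+g(e)$ otherwise. The height of $\pi$ is $h(\pi)=\max_{e\in E}\sup_{t\in\mathbb{N}}h^\pi_t(e)$.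
   Formalization: The coefficients λ(I) in the definition of a CBGT instance are taken rational rather than real; since g is rational, a nonnegative real solution of this linear system implies a nonnegative rational one. -}

module Defs where

open import Data.Bool using (if_then_else_)
open import Data.Fin using (Fin)
open import Data.Fin.Subset using (Subset; inside; outside; _∈_; _∉_; _⊆_; _∪_; ⊥; ⁅_⁆; ∣_∣)
open import Data.Fin.Subset.Properties using (_∈?_)
open import Data.List using (List; []; _∷_; _++_; map; filter; foldr; tabulate)
open import Data.Nat as ℕ using (ℕ; zero; suc)
open import Data.Product using (Σ; ∃; _×_)
open import Data.Rational using (ℚ; 0ℚ; 1ℚ; _+_; _≤_)
import Data.Rational.Properties as ℚ
open import Data.Vec using ([]; _∷_)
open import Level using (0ℓ)
open import Relation.Binary using (DecTotalOrder)
open import Relation.Binary.PropositionalEquality using (_≡_)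
open import Relation.Nullary.Decidable using (does; _×-dec_)
open import Relation.Unary using (Pred; Decidable)

open import Data.List.Extrema (DecTotalOrder.totalOrder ℚ.≤-decTotalOrder) using (max)

∑ : List ℚ → ℚ
∑ = foldr _+_ 0ℚ

-- Every subset of Fin n occurs exactly once.
subsets : ∀ n → List (Subset n)
subsets zero    = [] ∷ []
subsets (suc n) = map (outside ∷_) (subsets n) ++ map (inside ∷_) (subsets n)

-- The finite set E is Fin n.  An element of 2^(2^E) is represented by a
-- decidable predicate on subsets, so that sums over ℐ make sense.  As g is
-- rational, the linear system for λ has a nonnegative rational solution
-- whenever it has a nonnegative real one, so the coefficients are rational.
-- Values of coeff outside ℐ are irrelevant.
record CBGT (n : ℕ) : Set₁ where
  field
    ℐ  : Pred (Subset n) 0ℓ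
    ℐ? : Decidable ℐ
    g  : Fin n → ℚ
    g-nonneg : ∀ e → 0ℚ ≤ g e
    convex : Σ (Subset n → ℚ) λ coeff →
        (∀ I → ℐ I → 0ℚ ≤ coeff I)
      × ∑ (map coeff (filter ℐ? (subsets n))) ≡ 1ℚ
      × (∀ e → g e ≡ ∑ (map coeff (filter (λ I → ℐ? I ×-dec (e ∈? I)) (subsets n))))

record IsMatroid {n : ℕ} (ℐ : Pred (Subset n) 0ℓ) : Set where
  field
    empty      : ℐ ⊥
    hereditary : ∀ {A B} → A ⊆ B → ℐ B → ℐ A
    exchange   : ∀ {A B} → ℐ A → ℐ B → ∣ A ∣ ℕ.< ∣ B ∣ →
                 ∃ λ e → e ∈ B × e ∉ A × ℐ (A ∪ ⁅ e ⁆)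

-- Days are numbered from 0: index t stands for day t + 1.
Schedule : ℕ → Set
Schedule n = ℕ → Subset n

IsSup : (ℕ → ℚ) → ℚ → Set
IsSup f s = (∀ t → f t ≤ s) × (∀ b → (∀ t → f t ≤ b) → s ≤ b)

module _ {n : ℕ} (C : CBGT n) where
  open CBGT C

  Valid : Schedule n → Set
  Valid π = ∀ t → ℐ (π t)

  -- Height after growing and before cutting.
  heightOn : Schedule n → ℕ → Fin n → ℚ
  heightOn π zero    e = g e
  heightOn π (suc t) e = if does (e ∈? π t) then g e else heightOn π t e + g e

  -- h(π) may be infinite, so it is given as a relation: HasHeight π h says that
  -- all the suprema are finite and that h is their maximum.  Finite suprema are
  -- rational, because the heights of e are multiples of g e.  The base value 0ℚ
  -- only matters for empty E, as heights are nonnegative.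
  HasHeight : Schedule n → ℚ → Set
  HasHeight π h = Σ (Fin n → ℚ) λ s →
      (∀ e → IsSup (λ t → heightOn π t e) (s e))
    × h ≡ max 0ℚ (tabulate s)

{-# OPTIONS --safe #-}

-- Choose N such that all c e = N g(e) are integers.  On the cycle of length N
-- the bamboos can be given arcs of c e consecutive points such that at every
-- point the bamboos whose arcs contain it are independent (van den Heuvel and
-- Thomassé, Cyclic orderings and cyclic arboricity of matroids).  To get such
-- arcs, repeatedly move an arc forwards by one if its element is, at the first
-- point of the arc, spanned by the other elements present there; if this never
-- stopped, the moving elements would be too heavy for their rank.
--
-- On day t cut the bamboos whose arcs contain the point t s, where s / N is a
-- quotient of consecutive Fibonacci numbers.  By the golden ratio, such a
-- rotation returns to an arc of length c within fewer than 2 N / c days.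

module Submission where

open import Defs
open import Algebra.Bundles using (CommutativeRing)
import Algebra.Properties.Semiring.Sum as Sum
open import Data.Bool using (true; false; if_then_else_)
open import Data.Fin using (Fin; zero; suc; toℕ; fromℕ<)
import Data.Fin.Properties as Fin
open import Data.Fin.Subset using (Subset; inside; outside; _∈_; _∉_; _⊆_; _∪_; _∩_; _-_; ⊥; ⊤; ⁅_⁆; ∣_∣)
open import Data.Fin.Subset.Properties
open import Data.List as List using (List; []; _∷_; allFin; filter)
import Data.List.Membership.Propositional as List
open import Data.List.Membership.Propositional.Properties using (∈-allFin)
open import Data.List.Properties using (filter-accept; filter-reject)
import Data.List.Relation.Unary.All.Properties as All
open import Data.List.Relation.Unary.Any using (here; there)
open import Data.Nat as ℕ using (ℕ; zero; suc; z≤n; s≤s)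
import Data.Nat.Coprimality as ℕ
open import Data.Nat.DivMod using (_%_; m≡m%n+[m/n]*n; m<n⇒m%n≡m; m%n<n; m*n%n≡0; [m+n]%n≡m%n; [m+kn]%n≡m%n; %-distribˡ-+; m%n%n≡m%n)
open import Data.Nat.Induction using (<-wellFounded)
import Data.Nat.Properties as ℕ
open import Data.Nat.Solver using (module +-*-Solver)
open import Data.Product using (∃; ∃₂; Σ; _×_; _,_; proj₁; proj₂)
open import Data.Sum as ⊎ using (_⊎_; inj₁; inj₂; [_,_]′)
open import Data.Unit using (tt) renaming (⊤ to Unit)
open import Data.Vec using ([]; _∷_; tabulate; here; there)
open import Data.Vec.Functional using (updateAt; init; last)
open import Data.Vec.Functional.Properties using (updateAt-updates; updateAt-minimal)
open import Data.Vec.Properties using (lookup∘tabulate; lookup⇒[]=; []=⇒lookup; tabulate-cong)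
open import Function using (_∘_; id; case_of_)
open import Induction.WellFounded using (Acc; acc)
open import Level using (0ℓ)
open import Relation.Binary using (DecTotalOrder)
open import Relation.Binary.PropositionalEquality using (_≡_; _≢_; refl; sym; trans; cong; cong₂; subst; subst₂; module ≡-Reasoning)
open import Relation.Nullary using (¬_; Dec; yes; no; does; contradiction)
open import Relation.Nullary.Decidable using (_⊎-dec_; _×-dec_; ¬?; map′; decidable-stable; dec-true; dec-false)
open import Relation.Unary using (Pred; Decidable)

private variable
  n : ℕ
  Φ Ψ : Set

-- Why a set `A` of elements cannot keep moving: a push never shrinks the span at a point, since the
-- departing element is spanned by those that stay. So once every element of `A` has made a full
-- turn, the elements present at any point span all of `A`. The elements outside `A` cannot move,
-- hence are coloops wherever their arcs lie, and `A` is already spanned by its own members present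
-- at the point. Their number is at least the rank of `A` everywhere, and larger where a movable arc
-- begins. Summed over the cycle this exceeds `N` times the rank, although `g` is a convex
-- combination of independent sets, none of which meets `A` in more than its rank.
--
-- A rational rotation, instead of the golden one, makes the schedule periodic, so that the suprema
-- are attained and rational. The price is that the descent along the Fibonacci numbers stops at
-- moves of length `Q`; hence `N` is taken to be so large a multiple of the common denominator `Q`
-- that every nonempty arc has length at least `2 Q`.

module Discrete where
  open import Data.Nat using (_+_; _*_; _∸_; _≤_; _<_; _<?_; _≤?_; _⊔_)
  open import Data.Nat.DivMod using (_/_)
  open import Data.Nat.Properties
  open Sum ℕ.+-*-semiring using (sum; sum-cong-≗; ∑-comm; *-distribˡ-sum; sum-init-last)

  x∉p-x : ∀ (p : Subset n) x → x ∉ p - x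
  x∉p-x (b ∷ p) zero    ()
  x∉p-x (b ∷ p) (suc x) x∈ = x∉p-x p x (drop-there x∈)

  x∈p-y⇒x≢y : ∀ (p : Subset n) {x y} → x ∈ p - y → x ≢ y
  x∈p-y⇒x≢y p x∈p-y refl = x∉p-x p _ x∈p-y

  p-x⊆p : ∀ (p : Subset n) x → p - x ⊆ p
  p-x⊆p p x = p─q⊆p p ⁅ x ⁆

  ∪-lub : ∀ {p q r : Subset n} → p ⊆ r → q ⊆ r → p ∪ q ⊆ r
  ∪-lub {p = p} {q} p⊆r q⊆r x∈p∪q = [ p⊆r , q⊆r ]′ (x∈p∪q⁻ p q x∈p∪q)

  x∈p⇒⁅x⁆⊆p : ∀ {p : Subset n} {x} → x ∈ p → ⁅ x ⁆ ⊆ p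
  x∈p⇒⁅x⁆⊆p {x = x} x∈p y∈⁅x⁆ with refl ← x∈⁅y⁆⇒x≡y x y∈⁅x⁆ = x∈p

  x∈p∪⁅x⁆ : ∀ (p : Subset n) x → x ∈ p ∪ ⁅ x ⁆
  x∈p∪⁅x⁆ p x = q⊆p∪q p ⁅ x ⁆ (x∈⁅x⁆ x)

  ∪-monoˡ : ∀ {p q : Subset n} r → p ⊆ q → p ∪ r ⊆ q ∪ r
  ∪-monoˡ {q = q} r p⊆q = ∪-lub (p⊆p∪q r ∘ p⊆q) (q⊆p∪q q r)

  x∈p∪⁅y⁆⁻ : ∀ (p : Subset n) y {x} → x ∈ p ∪ ⁅ y ⁆ → x ∈ p ⊎ x ≡ y
  x∈p∪⁅y⁆⁻ p y x∈ with x∈p∪q⁻ p ⁅ y ⁆ x∈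
  ... | inj₁ x∈p = inj₁ x∈p
  ... | inj₂ x∈y = inj₂ (x∈⁅y⁆⇒x≡y y x∈y)

  -- Bases and closure in a matroid.

  module Closure {n : ℕ} {ℐ : Pred (Subset n) 0ℓ} (ℐ? : Decidable ℐ) (M : IsMatroid ℐ) where
    open IsMatroid M

    Spans : Subset n → Fin n → Set
    Spans J e = e ∈ J ⊎ ¬ ℐ (J ∪ ⁅ e ⁆)

    spans? : ∀ J e → Dec (Spans J e)
    spans? J e = (e ∈? J) ⊎-dec ¬? (ℐ? (J ∪ ⁅ e ⁆))

    ¬spans⇒ℐ : ∀ {J e} → ¬ Spans J e → ℐ (J ∪ ⁅ e ⁆)
    ¬spans⇒ℐ {J} {e} ¬sp = decidable-stable (ℐ? _) (¬sp ∘ inj₂)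

    spans-mono : ∀ {J K e} → J ⊆ K → Spans J e → Spans K e
    spans-mono J⊆K (inj₁ e∈J) = inj₁ (J⊆K e∈J)
    spans-mono J⊆K (inj₂ ¬ℐ)  = inj₂ (¬ℐ ∘ hereditary (∪-monoˡ _ J⊆K))

    -- Otherwise the exchange axiom would extend `J` by an element of `K`, which `J` spans.
    spanned⇒∣∣≤ : ∀ {J K} → ℐ J → ℐ K → (∀ {e} → e ∈ K → Spans J e) → ∣ K ∣ ≤ ∣ J ∣
    spanned⇒∣∣≤ {J} {K} ℐJ ℐK sp with ∣ K ∣ ℕ.≤? ∣ J ∣
    ... | yes K≤J = K≤J
    ... | no  K≰J with e , e∈K , e∉J , ℐJe ← exchange ℐJ ℐK (≰⇒> K≰J) | sp e∈K
    ...   | inj₁ e∈J = contradiction e∈J e∉J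
    ...   | inj₂ ¬ℐ  = contradiction ℐJe ¬ℐ

    record Basis (S : Subset n) : Set where
      field
        set     : Subset n
        set⊆    : set ⊆ S
        indep   : ℐ set
        spans   : ∀ {e} → e ∈ S → Spans set e
    open Basis public

    -- The greedy algorithm: an element once refused stays spanned as the set grows.
    extendBy : ∀ {S J} → J ⊆ S → ℐ J → (es : List (Fin n)) →
               ∃ λ K → J ⊆ K × K ⊆ S × ℐ K × (∀ {e} → e List.∈ es → e ∈ S → Spans K e)
    extendBy {J = J} J⊆S ℐJ [] = J , id , J⊆S , ℐJ , λ ()
    extendBy {S} {J} J⊆S ℐJ (e ∷ es) with (e ∈? S) ×-dec ℐ? (J ∪ ⁅ e ⁆)
    ... | yes (e∈S , ℐJe)
      with K , Je⊆K , K⊆S , ℐK , sp ← extendBy (∪-lub J⊆S (x∈p⇒⁅x⁆⊆p e∈S)) ℐJe es =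
      K , Je⊆K ∘ p⊆p∪q _ , K⊆S , ℐK , λ where
        (here refl) _ → inj₁ (Je⊆K (x∈p∪⁅x⁆ J e))
        (there f∈)    → sp f∈
    ... | no ¬p with K , J⊆K , K⊆S , ℐK , sp ← extendBy J⊆S ℐJ es =
      K , J⊆K , K⊆S , ℐK , λ where
        (here refl) e∈S → spans-mono J⊆K (inj₂ λ ℐJe → ¬p (e∈S , ℐJe))
        (there f∈)      → sp f∈

    extend : ∀ {S J} → J ⊆ S → ℐ J → Σ (Basis S) λ B → J ⊆ set B
    extend J⊆S ℐJ with K , J⊆K , K⊆S , ℐK , sp ← extendBy J⊆S ℐJ (allFin n) =
      record { set = K ; set⊆ = K⊆S ; indep = ℐK ; spans = sp (∈-allFin _) } , J⊆K

    basis : ∀ S → Basis S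
    basis S = proj₁ (extend {S} ⊥⊆ empty)

    infix 4 _∈cl_ _∉cl_
    -- The witness has to be independent, because a dependent `J` satisfies `Spans J e` for every
    -- `e`.
    _∈cl_ _∉cl_ : Fin n → Subset n → Set
    e ∈cl S = ∃ λ J → J ⊆ S × ℐ J × Spans J e
    e ∉cl S = ¬ e ∈cl S

    ∈⇒∈cl : ∀ {S e} → e ∈ S → e ∈cl S
    ∈⇒∈cl {S} e∈S = let B = basis S in set B , set⊆ B , indep B , spans B e∈S

    cl-mono : ∀ {S T e} → S ⊆ T → e ∈cl S → e ∈cl T
    cl-mono S⊆T (J , J⊆S , rest) = J , S⊆T ∘ J⊆S , rest

    -- A basis `C` extending the witness `J` spans `set B` and `e`. Were `set B ∪ ⁅ e ⁆`
    -- independent, it would be no larger than `C`, which is no larger than `set B`.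
    basis-spans-cl : ∀ {S e} (B : Basis S) → e ∈cl S → Spans (set B) e
    basis-spans-cl {S} {e} B (J , J⊆S , ℐJ , sp) with spans? (set B) e
    ... | yes p = p
    ... | no ¬p with C , J⊆C ← extend J⊆S ℐJ =
      contradiction (≤-trans (spanned⇒∣∣≤ (indep C) (¬spans⇒ℐ ¬p) Be-spanned)
                             (spanned⇒∣∣≤ (indep B) (indep C) (spans B ∘ set⊆ C)))
                    (<⇒≱ (p⊂q⇒∣p∣<∣q∣ (p⊆p∪q _ , e , x∈p∪⁅x⁆ _ e , ¬p ∘ inj₁)))
      where
      Be-spanned : ∀ {x} → x ∈ set B ∪ ⁅ e ⁆ → Spans (set C) x
      Be-spanned x∈ with x∈p∪⁅y⁆⁻ (set B) e x∈
      ... | inj₁ x∈B  = spans C (set⊆ B x∈B)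
      ... | inj₂ refl = spans-mono J⊆C sp

    _∈cl?_ : ∀ e S → Dec (e ∈cl S)
    e ∈cl? S = map′ (λ sp → set B , set⊆ B , indep B , sp) (basis-spans-cl B) (spans? (set B) e)
      where B = basis S

    -- A basis of `S` is also a basis of `S ∪ T`.
    cl-trans : ∀ {S T e} → (∀ {x} → x ∈ T → x ∈cl S) → e ∈cl T → e ∈cl S
    cl-trans {S} {T} {e} T⊆clS e∈clT = set B , set⊆ B , indep B ,
      basis-spans-cl B′ (cl-mono (q⊆p∪q S T) e∈clT)
      where
      B = basis S
      B′ : Basis (S ∪ T)
      B′ = record
        { set   = set B
        ; set⊆  = p⊆p∪q T ∘ set⊆ B
        ; indep = indep B
        ; spans = [ spans B , basis-spans-cl B ∘ T⊆clS ]′ ∘ x∈p∪q⁻ S T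
        }

    -- The exchange property of Steinitz and Mac Lane. If `J ∪ ⁅ x ⁆` did not span `y`, then `J`
    -- with `x` and `y` would be independent, and the basis `J ∪ ⁅ y ⁆` of `S ∪ ⁅ y ⁆` could not
    -- span `x`.
    cl-exchange : ∀ {S x y} → x ∉cl S → x ∈cl S ∪ ⁅ y ⁆ → y ∈cl S ∪ ⁅ x ⁆
    cl-exchange {S} {x} {y} x∉ x∈ = set Bx , set⊆ Bx , indep Bx , goal
      where
      B = basis S
      J = set B
      ¬spx : ¬ Spans J x
      ¬spx sp = x∉ (J , set⊆ B , indep B , sp)
      spans∪ : ∀ {e z} → e ∈ S ∪ ⁅ z ⁆ → Spans (J ∪ ⁅ z ⁆) e
      spans∪ {e} {z} e∈ with x∈p∪⁅y⁆⁻ S z e∈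
      ... | inj₁ e∈S  = spans-mono (p⊆p∪q _) (spans B e∈S)
      ... | inj₂ refl = inj₁ (x∈p∪⁅x⁆ J z)
      Bx : Basis (S ∪ ⁅ x ⁆)
      Bx = record { set = J ∪ ⁅ x ⁆ ; set⊆ = ∪-monoˡ _ (set⊆ B) ; indep = ¬spans⇒ℐ ¬spx ; spans = spans∪ }
      swap : (J ∪ ⁅ y ⁆) ∪ ⁅ x ⁆ ⊆ (J ∪ ⁅ x ⁆) ∪ ⁅ y ⁆
      swap = ∪-lub (∪-monoˡ ⁅ y ⁆ (p⊆p∪q ⁅ x ⁆)) (p⊆p∪q ⁅ y ⁆ ∘ q⊆p∪q J ⁅ x ⁆)
      goal : Spans (J ∪ ⁅ x ⁆) y
      goal = decidable-stable (spans? (J ∪ ⁅ x ⁆) y) λ ¬spy →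
        let ℐJyx = hereditary swap (¬spans⇒ℐ ¬spy)
            By : Basis (S ∪ ⁅ y ⁆)
            By = record { set = J ∪ ⁅ y ⁆ ; set⊆ = ∪-monoˡ _ (set⊆ B)
                        ; indep = hereditary (p⊆p∪q ⁅ x ⁆) ℐJyx ; spans = spans∪ }
            x≢y : x ≢ y
            x≢y x≡y = ¬spy (inj₁ (subst (_∈ J ∪ ⁅ x ⁆) x≡y (x∈p∪⁅x⁆ J x)))
        in case basis-spans-cl By x∈ of λ where
          (inj₁ x∈Jy) → [ ¬spx ∘ inj₁ , x≢y ]′ (x∈p∪⁅y⁆⁻ J y x∈Jy)
          (inj₂ ¬ℐ)   → ¬ℐ ℐJyx

    basis-size-mono : ∀ {S T} (B : Basis S) (C : Basis T) → (∀ {e} → e ∈ S → e ∈cl T) → ∣ set B ∣ ≤ ∣ set C ∣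
    basis-size-mono B C S⊆clT = spanned⇒∣∣≤ (indep C) (indep B) (basis-spans-cl C ∘ S⊆clT ∘ set⊆ B)

    -- The elements outside `Y′` are removed one at a time. If removing `x` lost `e`, exchange would
    -- put `x` into the closure of `e` and the remaining elements, all in `W - x`; but `x` is a
    -- coloop of `W`.
    drop-coloops : ∀ {W Y Y′ e} → Y ⊆ W → e ∈ W → (e ∈ Y → e ∈ Y′) →
                   (∀ {x} → x ∈ Y → x ∉ Y′ → x ∉cl W - x) →
                   e ∈cl Y → e ∈cl Y ∩ Y′
    drop-coloops {W} {Y} {Y′} {e} Y⊆W e∈W e∈Y⇒e∈Y′ coloop =
      go Y id Y⊆W (<-wellFounded _)
      where
      go : ∀ Z → Z ⊆ Y → Z ⊆ W → Acc _<_ ∣ Z ∣ → e ∈cl Z → e ∈cl Y ∩ Y′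
      go Z Z⊆Y Z⊆W (acc rec) e∈clZ with Fin.any? (λ x → (x ∈? Z) ×-dec ¬? (x ∈? Y′))
      ... | no none = cl-mono Z⊆Y∩Y′ e∈clZ
        where
        Z⊆Y∩Y′ : Z ⊆ Y ∩ Y′
        Z⊆Y∩Y′ {x} x∈Z = x∈p∩q⁺ (Z⊆Y x∈Z , decidable-stable (x ∈? Y′) (λ x∉Y′ → none (x , x∈Z , x∉Y′)))
      ... | yes (x , x∈Z , x∉Y′) with e ∈cl? (Z - x)
      ...   | yes e∈clZ-x = go (Z - x) (Z⊆Y ∘ p-x⊆p Z x) (Z⊆W ∘ p-x⊆p Z x) (rec (x∈p⇒∣p-x∣<∣p∣ x∈Z)) e∈clZ-x
      ...   | no  e∉clZ-x = contradiction
        (cl-mono sub (cl-exchange e∉clZ-x (cl-mono restore e∈clZ)))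
        (coloop (Z⊆Y x∈Z) x∉Y′)
        where
        restore : Z ⊆ (Z - x) ∪ ⁅ x ⁆
        restore {z} z∈Z with z Fin.≟ x
        ... | yes refl = x∈p∪⁅x⁆ (Z - x) x
        ... | no z≢x   = p⊆p∪q ⁅ x ⁆ (x∈p∧x≢y⇒x∈p-y z∈Z z≢x)
        e≢x : e ≢ x
        e≢x refl = x∉Y′ (e∈Y⇒e∈Y′ (Z⊆Y x∈Z))
        sub : (Z - x) ∪ ⁅ e ⁆ ⊆ W - x
        sub = ∪-lub (λ z∈ → x∈p∧x≢y⇒x∈p-y (Z⊆W (p-x⊆p Z x z∈)) (x∈p-y⇒x≢y Z z∈))
                    (x∈p⇒⁅x⁆⊆p (x∈p∧x≢y⇒x∈p-y e∈W e≢x))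

  -- Finite sums, counting and residues.

  sum-mono-≤ : ∀ {n} {f g : Fin n → ℕ} → (∀ i → f i ≤ g i) → sum f ≤ sum g
  sum-mono-≤ {zero}  f≤g = z≤n
  sum-mono-≤ {suc n} f≤g = +-mono-≤ (f≤g zero) (sum-mono-≤ (f≤g ∘ suc))

  sum-mono-< : ∀ {n} {f g : Fin n → ℕ} → (∀ i → f i ≤ g i) → ∀ j → f j < g j → sum f < sum g
  sum-mono-< f≤g zero    fj<gj = +-mono-<-≤ fj<gj (sum-mono-≤ (f≤g ∘ suc))
  sum-mono-< f≤g (suc j) fj<gj = +-mono-≤-< (f≤g zero) (sum-mono-< (f≤g ∘ suc) j fj<gj)

  term≤sum : ∀ {n} (f : Fin n → ℕ) i → f i ≤ sum f
  term≤sum f zero    = m≤m+n _ _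
  term≤sum f (suc i) = ≤-trans (term≤sum (f ∘ suc) i) (m≤n+m _ _)

  sum-const : ∀ n k → sum {n} (λ _ → k) ≡ n * k
  sum-const zero    k = refl
  sum-const (suc n) k = cong (k +_) (sum-const n k)

  sum-snoc : ∀ (h : ℕ → ℕ) n → sum {suc n} (h ∘ toℕ) ≡ sum {n} (h ∘ toℕ) + h n
  sum-snoc h n = begin
    sum {suc n} (h ∘ toℕ)                        ≡⟨ sum-init-last (h ∘ toℕ) ⟩
    sum (init (h ∘ toℕ {suc n})) + last {n = n} (h ∘ toℕ) ≡⟨ cong₂ _+_ (sum-cong-≗ {n} (cong h ∘ Fin.toℕ-inject₁)) (cong h (Fin.toℕ-fromℕ n)) ⟩
    sum {n} (h ∘ toℕ) + h n                      ∎
    where open ≡-Reasoning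

  sum-shift : ∀ (h : ℕ → ℕ) N → (∀ x → h (x + N) ≡ h x) → ∀ a →
              sum {N} (λ i → h (toℕ i + a)) ≡ sum {N} (h ∘ toℕ)
  sum-shift h N periodic zero    = sum-cong-≗ {N} (λ i → cong h (+-identityʳ (toℕ i)))
  sum-shift h N periodic (suc a) = begin
    sum {N} (λ i → h (toℕ i + suc a)) ≡⟨ sum-cong-≗ {N} (λ i → cong h (+-suc (toℕ i) a)) ⟩
    -- With `h′ 0` added, both sides are the sum of the first `N + 1` values of `h′`, as `h′ N`
    -- equals `h′ 0`.
    sum {N} (λ i → h′ (suc (toℕ i)))  ≡⟨ +-cancelˡ-≡ (h′ 0) _ _ (trans (sum-snoc h′ N) (trans (+-comm (sum {N} (h′ ∘ toℕ)) _) (cong (_+ sum {N} (h′ ∘ toℕ)) h′N≡h′0))) ⟩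
    sum {N} (h′ ∘ toℕ)                ≡⟨ sum-shift h N periodic a ⟩
    sum {N} (h ∘ toℕ)                 ∎
    where
    open ≡-Reasoning
    h′ : ℕ → ℕ
    h′ x = h (x + a)
    h′N≡h′0 : h′ N ≡ h′ 0
    h′N≡h′0 = trans (cong h (+-comm N a)) (periodic a)

  𝟙 : Dec Φ → ℕ
  𝟙 P? = if does P? then 1 else 0

  𝟙-true : (P? : Dec Φ) → Φ → 𝟙 P? ≡ 1
  𝟙-true P? p rewrite dec-true P? p = refl

  𝟙-false : (P? : Dec Φ) → ¬ Φ → 𝟙 P? ≡ 0
  𝟙-false P? ¬p rewrite dec-false P? ¬p = refl

  𝟙-cong : (P? : Dec Φ) (Q? : Dec Ψ) → (Φ → Ψ) → (Ψ → Φ) → 𝟙 P? ≡ 𝟙 Q?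
  𝟙-cong (yes p) Q? f g = sym (𝟙-true Q? (f p))
  𝟙-cong (no ¬p) Q? f g = sym (𝟙-false Q? (¬p ∘ g))

  𝟙-× : (P? : Dec Φ) (Q? : Dec Ψ) → 𝟙 (P? ×-dec Q?) ≡ 𝟙 P? * 𝟙 Q?
  𝟙-× (yes _) (yes _) = refl
  𝟙-× (yes _) (no  _) = refl
  𝟙-× (no  _) Q?      = refl

  𝟙-∩ : ∀ {n} (p q : Subset n) x → 𝟙 (x ∈? p ∩ q) ≡ 𝟙 (x ∈? p) * 𝟙 (x ∈? q)
  𝟙-∩ p q x = trans (𝟙-cong (x ∈? p ∩ q) ((x ∈? p) ×-dec (x ∈? q)) (x∈p∩q⁻ p q) x∈p∩q⁺) (𝟙-× (x ∈? p) (x ∈? q))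

  ∣∣≡sum : ∀ (p : Subset n) → ∣ p ∣ ≡ sum (λ i → 𝟙 (i ∈? p))
  ∣∣≡sum []            = refl
  ∣∣≡sum (inside  ∷ p) = cong suc (trans (∣∣≡sum p) (sum-cong-≗ λ i → 𝟙-cong (i ∈? p) (suc i ∈? inside ∷ p) there drop-there))
  ∣∣≡sum (outside ∷ p) = trans (∣∣≡sum p) (sum-cong-≗ λ i → 𝟙-cong (i ∈? p) (suc i ∈? outside ∷ p) there drop-there)

  sum-below : ∀ {c n} → c ≤ n → sum {n} (λ i → 𝟙 (toℕ i <? c)) ≡ c
  sum-below {zero}  {n}     _         = trans (sum-cong-≗ {n} λ i → 𝟙-false (toℕ i <? 0) λ ()) (trans (sum-const n 0) (*-zeroʳ n))
  sum-below {suc c} {suc n} (s≤s c≤n) = cong suc (trans (sum-cong-≗ {n} λ i → 𝟙-cong (suc (toℕ i) <? suc c) (toℕ i <? c) ℕ.s≤s⁻¹ s≤s) (sum-below c≤n))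

  ⟪_⟫ : {P : Pred (Fin n) 0ℓ} → Decidable P → Subset n
  ⟪ P? ⟫ = tabulate (does ∘ P?)

  ∈⟪⟫⁺ : ∀ {P : Pred (Fin n) 0ℓ} (P? : Decidable P) {x} → P x → x ∈ ⟪ P? ⟫
  ∈⟪⟫⁺ P? {x} px = lookup⇒[]= x _ (trans (lookup∘tabulate _ x) (dec-true (P? x) px))

  ∈⟪⟫⁻ : ∀ {P : Pred (Fin n) 0ℓ} (P? : Decidable P) {x} → x ∈ ⟪ P? ⟫ → P x
  ∈⟪⟫⁻ P? {x} x∈ with P? x | trans (sym (lookup∘tabulate (does ∘ P?) x)) ([]=⇒lookup x∈)
  ... | yes px | _ = px

  module _ (m : ℕ) where
    private N = suc m

    -- Adding `m` serves as subtraction of 1 modulo `N`, which avoids truncated subtraction.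
    [x+m]%N≡d : ∀ x {d} → x % N ≡ suc d → (x + m) % N ≡ d
    [x+m]%N≡d x {d} eq = begin
      (x + m) % N                  ≡⟨ cong (λ y → (y + m) % N) (trans (m≡m%n+[m/n]*n x N) (cong (_+ x / N * N) eq)) ⟩
      (suc d + x / N * N + m) % N  ≡⟨ cong (_% N) (lemma d (x / N * N) m) ⟩
      (d + x / N * N + N) % N      ≡⟨ [m+n]%n≡m%n (d + x / N * N) N ⟩
      (d + x / N * N) % N          ≡⟨ [m+kn]%n≡m%n d (x / N) N ⟩
      d % N                        ≡⟨ m<n⇒m%n≡m (<-trans (n<1+n d) (subst (_< N) eq (m%n<n x N))) ⟩
      d                            ∎
      where
      open ≡-Reasoning
      lemma : ∀ d y m → suc d + y + m ≡ d + y + suc m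
      lemma d y m = sym (+-suc (d + y) m)

    [x%N+y]%N : ∀ x y → (x % N + y) % N ≡ (x + y) % N
    [x%N+y]%N x y = trans (%-distribˡ-+ (x % N) y N) (trans (cong (λ z → (z + y % N) % N) (m%n%n≡m%n x N)) (sym (%-distribˡ-+ x y N)))

    -- Adding `m * a` completes `a` to a multiple of `N`.
    %-cancelʳ-+ : ∀ x y a → (x + a) % N ≡ (y + a) % N → x % N ≡ y % N
    %-cancelʳ-+ x y a eq = trans (sym (undo x)) (trans (cong (λ z → (z + m * a) % N) eq) (undo y))
      where
      undo : ∀ x → ((x + a) % N + m * a) % N ≡ x % N
      undo x = begin
        ((x + a) % N + m * a) % N ≡⟨ [x%N+y]%N (x + a) (m * a) ⟩
        (x + a + m * a) % N       ≡⟨ cong (_% N) (+-assoc x a (m * a)) ⟩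
        (x + N * a) % N           ≡⟨ cong (λ z → (x + z) % N) (*-comm N a) ⟩
        (x + a * N) % N           ≡⟨ [m+kn]%n≡m%n x a N ⟩
        x % N                     ∎
        where open ≡-Reasoning

  -- Arcs on a cycle that are independent at every point.

  module Arcs {n : ℕ} {ℐ : Pred (Subset n) 0ℓ} (ℐ? : Decidable ℐ) (M : IsMatroid ℐ)
              (m : ℕ) (c : Fin n → ℕ) (c≤N : ∀ e → c e ≤ suc m)
              (sparse : ∀ {A J} → ℐ J → (∀ {e} → e ∈ A → Closure.Spans ℐ? M J e) →
                        sum (λ e → 𝟙 (e ∈? A) * c e) ≤ suc m * ∣ J ∣)
              where
    open IsMatroid M
    open Closure ℐ? M

    N : ℕ
    N = suc m

    -- The arc of e begins at the points θ with θ + s e ≡ 0 (mod N).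
    State : Set
    State = Fin n → ℕ

    opaque
      phase : State → ℕ → Fin n → ℕ
      phase s θ e = (θ + s e) % N

      phase-def : ∀ s θ e → phase s θ e ≡ (θ + s e) % N
      phase-def s θ e = refl

      active : State → ℕ → Subset n
      active s θ = ⟪ (λ e → phase s θ e <? c e) ⟫

      ∈active⁺ : ∀ {s θ e} → phase s θ e < c e → e ∈ active s θ
      ∈active⁺ {s} {θ} = ∈⟪⟫⁺ (λ e → phase s θ e <? c e)

      ∈active⁻ : ∀ {s θ e} → e ∈ active s θ → phase s θ e < c e
      ∈active⁻ {s} {θ} = ∈⟪⟫⁻ (λ e → phase s θ e <? c e)

      active-cong : ∀ s θ θ′ → θ % N ≡ θ′ % N → active s θ ≡ active s θ′
      active-cong s θ θ′ eq = tabulate-cong λ e → cong (λ d → does (d <? c e))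
        (trans (sym ([x%N+y]%N m θ (s e))) (trans (cong (λ x → (x + s e) % N) eq) ([x%N+y]%N m θ′ (s e))))

    -- A representative of `- s e` modulo `N`, the first point of the arc of `e`.
    origin : State → Fin n → ℕ
    origin s e = m * s e

    origin≡0 : ∀ s e → (origin s e + s e) % N ≡ 0
    origin≡0 s e = trans (cong (_% N) (trans (+-comm (m * s e) (s e)) (*-comm N (s e)))) (m*n%n≡0 (s e) N)

    -- Empty arcs are excluded: their elements may be spanned for ever, as moving them changes
    -- nothing.
    Pushable : State → Fin n → Set
    Pushable s e = 0 < c e × e ∈cl active s (origin s e) - e

    pushable? : ∀ s e → Dec (Pushable s e)
    pushable? s e = (0 <? c e) ×-dec (e ∈cl? (active s (origin s e) - e))

    active-origin : ∀ s {θ e} → phase s θ e ≡ 0 → active s θ ≡ active s (origin s e)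
    active-origin s {θ} {e} eq = active-cong s θ (origin s e)
      (%-cancelʳ-+ m θ (origin s e) (s e) (trans (sym (phase-def s θ e)) (trans eq (sym (origin≡0 s e)))))

    pushable⇒∈cl : ∀ {s θ e} → Pushable s e → phase s θ e ≡ 0 → e ∈cl active s θ - e
    pushable⇒∈cl {s} {e = e} (_ , e∈cl) eq = subst (λ I → e ∈cl I - e) (sym (active-origin s eq)) e∈cl

    ¬pushable⇒∉cl : ∀ {s θ e} → ¬ Pushable s e → phase s θ e ≡ 0 → 0 < c e → e ∉cl active s θ - e
    ¬pushable⇒∉cl {s} {e = e} ¬p eq 0<c e∈cl =
      ¬p (0<c , subst (λ I → e ∈cl I - e) (active-origin s eq) e∈cl)

    -- As m ≡ - 1 (mod N), this moves the arc of f forwards by one point.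
    push : State → Fin n → State
    push s f = updateAt s f (_+ m)

    phase-push-≢ : ∀ s θ {e f} → e ≢ f → phase (push s f) θ e ≡ phase s θ e
    phase-push-≢ s θ {e} {f} e≢f = trans (phase-def _ θ e)
      (trans (cong (λ x → (θ + x) % N) (updateAt-minimal e f s e≢f)) (sym (phase-def s θ e)))

    phase-push : ∀ s θ f → phase (push s f) θ f ≡ (θ + s f + m) % N
    phase-push s θ f = trans (phase-def _ θ f) (cong (_% N) (trans (cong (θ +_) (updateAt-updates f s)) (sym (+-assoc θ (s f) m))))

    phase-push-suc : ∀ s θ {f d} → phase s θ f ≡ suc d → phase (push s f) θ f ≡ d
    phase-push-suc s θ {f} eq = trans (phase-push s θ f) ([x+m]%N≡d m (θ + s f) (trans (sym (phase-def s θ f)) eq))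

    active-push : ∀ {s θ e f} → e ∈ active s θ → e ∈ active (push s f) θ ⊎ (e ≡ f × phase s θ f ≡ 0)
    active-push {s} {θ} {e} {f} e∈ with e Fin.≟ f
    ... | no e≢f = inj₁ (∈active⁺ (subst (_< c e) (sym (phase-push-≢ s θ e≢f)) (∈active⁻ e∈)))
    ... | yes refl with phase s θ e in eq
    ...   | zero  = inj₂ (refl , refl)
    ...   | suc d = inj₁ (∈active⁺ (subst (_< c e) (sym (phase-push-suc s θ eq))
                      (<-trans (n<1+n d) (subst (_< c e) eq (∈active⁻ e∈)))))

    -- Only `f` can disappear, and only from the first point of its arc, where the other elements
    -- present span it.
    cl-push : ∀ {s θ f e} → Pushable s f → e ∈cl active s θ → e ∈cl active (push s f) θ
    cl-push {s} {θ} {f} pf = cl-trans λ {x} x∈ → case active-push x∈ of λ where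
        (inj₁ x∈′)         → ∈⇒∈cl x∈′
        (inj₂ (refl , eq)) → cl-mono (keep eq) (pushable⇒∈cl pf eq)
      where
      keep : phase s θ f ≡ 0 → active s θ - f ⊆ active (push s f) θ
      keep eq {x} x∈ = case active-push (p-x⊆p (active s θ) f x∈) of λ where
        (inj₁ x∈′)        → x∈′
        (inj₂ (refl , _)) → contradiction x∈ (x∉p-x _ f)

    -- If `f` leaves `θ`, it has to be spanned there without `b` too. Otherwise exchange would put
    -- `b` into the closure of the other elements present, and `b` would be pushable.
    cl-push-avoiding : ∀ {s θ f b e} → Pushable s f → b ≢ f → ¬ Pushable s b → phase s θ b ≡ 0 → 0 < c b →
                       e ∈cl active s θ - b → e ∈cl active (push s f) θ - b
    cl-push-avoiding {s} {θ} {f} {b} pf b≢f ¬pb b-starts 0<cb = cl-trans λ {x} x∈ →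
        case active-push (p-x⊆p I b x∈) of λ where
          (inj₁ x∈′)         → ∈⇒∈cl (x∈p∧x≢y⇒x∈p-y x∈′ (x∈p-y⇒x≢y I x∈))
          (inj₂ (refl , eq)) → cl-mono keep (f∈cl eq)
      where
      I = active s θ
      Y = I - f - b
      keep : Y ⊆ active (push s f) θ - b
      keep {x} x∈ = case active-push (p-x⊆p I f (p-x⊆p (I - f) b x∈)) of λ where
        (inj₁ x∈′)        → x∈p∧x≢y⇒x∈p-y x∈′ (x∈p-y⇒x≢y (I - f) x∈)
        (inj₂ (refl , _)) → contradiction (p-x⊆p (I - f) b x∈) (x∉p-x I f)
      restore : I - f ⊆ Y ∪ ⁅ b ⁆
      restore {x} x∈ with x Fin.≟ b
      ... | yes refl = x∈p∪⁅x⁆ Y b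
      ... | no x≢b   = p⊆p∪q ⁅ b ⁆ (x∈p∧x≢y⇒x∈p-y x∈ x≢b)
      f∈cl : phase s θ f ≡ 0 → f ∈cl Y
      f∈cl eq = decidable-stable (f ∈cl? Y) λ f∉cl →
        ¬pushable⇒∉cl ¬pb b-starts 0<cb
          (cl-mono (∪-lub (λ z∈ → x∈p∧x≢y⇒x∈p-y (p-x⊆p I f (p-x⊆p (I - f) b z∈)) (x∈p-y⇒x≢y (I - f) z∈))
                          (x∈p⇒⁅x⁆⊆p (x∈p∧x≢y⇒x∈p-y (∈active⁺ (subst (_< c f) (sym eq) (proj₁ pf))) (b≢f ∘ sym))))
                   (cl-exchange f∉cl (cl-mono restore (pushable⇒∈cl pf eq))))

    module _ (A : Subset n) (s : State)
             (start-coloop : ∀ {θ b} → b ∉ A → phase s θ b ≡ 0 → 0 < c b → b ∉cl (A ∪ active s θ) - b)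
             where

      -- Moving back from θ to θ - 1, the arcs that begin at θ disappear, but
      -- these are coloops and cannot help to span b.
      active-coloop : ∀ {θ b} → b ∉ A → b ∈ active s θ → b ∉cl (A ∪ active s θ) - b
      active-coloop {θ} {b} b∉A b∈ = go _ θ refl (∈active⁻ b∈)
        where
        go : ∀ d θ → phase s θ b ≡ d → phase s θ b < c b → b ∉cl (A ∪ active s θ) - b
        go zero    θ eq d<c = start-coloop b∉A eq (subst (_< c b) eq d<c)
        go (suc d) θ eq d<c b∈cl = go d (θ + m) (previous eq) (subst (_< c b) (sym (previous eq)) d<c′)
          (cl-mono sub (drop-coloops {W = W} {Y′ = W′} (p-x⊆p W b) (q⊆p∪q A _ (∈active⁺ d<c))
            (λ b∈Y → contradiction b∈Y (x∉p-x W b)) coloop b∈cl))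
          where
          W = A ∪ active s θ
          W′ = A ∪ active s (θ + m)
          d<c′ : d < c b
          d<c′ = <-trans (n<1+n d) (subst (_< c b) eq d<c)
          previous : ∀ {e k} → phase s θ e ≡ suc k → phase s (θ + m) e ≡ k
          previous {e} eq = trans (trans (phase-def s _ e) (cong (_% N) (trans (+-assoc θ m (s e)) (trans (cong (θ +_) (+-comm m (s e))) (sym (+-assoc θ (s e) m))))))
            ([x+m]%N≡d m (θ + s e) (trans (sym (phase-def s θ e)) eq))
          sub : (W - b) ∩ W′ ⊆ W′ - b
          sub x∈ = let x∈Y , x∈W′ = x∈p∩q⁻ (W - b) W′ x∈ in x∈p∧x≢y⇒x∈p-y x∈W′ (x∈p-y⇒x≢y W x∈Y)
          coloop : ∀ {x} → x ∈ W - b → x ∉ W′ → x ∉cl W - x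
          coloop {x} x∈ x∉W′ with x∈p∪q⁻ A _ (p-x⊆p W b x∈)
          ... | inj₁ x∈A = contradiction (p⊆p∪q _ x∈A) x∉W′
          ... | inj₂ x∈I with phase s θ x in eqx
          ...   | zero  = start-coloop (x∉W′ ∘ p⊆p∪q _) eqx (subst (_< c x) eqx (∈active⁻ x∈I))
          ...   | suc k = contradiction
            (q⊆p∪q A _ (∈active⁺ (subst (_< c x) (sym (previous eqx)) (<-trans (n<1+n k) (subst (_< c x) eqx (∈active⁻ x∈I)))))) x∉W′

    -- The case of an empty `A`: every element present is a coloop, so a basis contains all of them.
    stable⇒ℐ : ∀ {s} → (∀ e → ¬ Pushable s e) → ∀ θ → ℐ (active s θ)
    stable⇒ℐ {s} stable θ = hereditary I⊆B (indep B)
      where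
      I = active s θ
      B = basis I
      ⊥∪ : ∀ {p : Subset n} → ⊥ ∪ p ⊆ p
      ⊥∪ = ∪-lub ⊥⊆ id
      minus-mono : ∀ {p q : Subset n} x → p ⊆ q → p - x ⊆ q - x
      minus-mono {p} x p⊆q z∈ = x∈p∧x≢y⇒x∈p-y (p⊆q (p-x⊆p p x z∈)) (x∈p-y⇒x≢y p z∈)
      coloop : ∀ {x} → x ∈ I → x ∉cl (⊥ ∪ I) - x
      coloop = active-coloop ⊥ s (λ {θ} {b} _ eq 0<c → ¬pushable⇒∉cl (stable b) eq 0<c ∘ cl-mono (minus-mono b ⊥∪)) ∉⊥
      I⊆B : I ⊆ set B
      I⊆B {x} x∈I = decidable-stable (x ∈? set B) λ x∉B → coloop x∈I
        (set B , (λ y∈B → x∈p∧x≢y⇒x∈p-y (q⊆p∪q ⊥ I (set⊆ B y∈B)) λ { refl → x∉B y∈B }) , indep B , spans B x∈I)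

    sum-active : ∀ s e → sum {N} (λ θ → 𝟙 (e ∈? active s (toℕ θ))) ≡ c e
    sum-active s e = begin
      sum {N} (λ θ → 𝟙 (e ∈? active s (toℕ θ)))   ≡⟨ sum-cong-≗ {N} (λ θ → trans (𝟙-cong (e ∈? _) (_ <? c e) ∈active⁻ ∈active⁺) (cong (λ d → 𝟙 (d <? c e)) (phase-def s (toℕ θ) e))) ⟩
      sum {N} (λ θ → h (toℕ θ + s e))             ≡⟨ sum-shift h N (λ x → cong (λ d → 𝟙 (d <? c e)) ([m+n]%n≡m%n x N)) (s e) ⟩
      sum {N} (λ θ → h (toℕ θ))                   ≡⟨ sum-cong-≗ {N} (λ θ → cong (λ d → 𝟙 (d <? c e)) (m<n⇒m%n≡m (Fin.toℕ<n θ))) ⟩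
      sum {N} (λ θ → 𝟙 (toℕ θ <? c e))            ≡⟨ sum-below (c≤N e) ⟩
      c e                                         ∎
      where
      open ≡-Reasoning
      h : ℕ → ℕ
      h x = 𝟙 (x % N <? c e)

    -- Counts in two ways the pairs of a point and an element of `A` whose arc contains it.
    sum-∩active : ∀ s A → sum {N} (λ θ → ∣ active s (toℕ θ) ∩ A ∣) ≡ sum (λ e → 𝟙 (e ∈? A) * c e)
    sum-∩active s A = begin
      sum {N} (λ θ → ∣ active s (toℕ θ) ∩ A ∣)                                ≡⟨ sum-cong-≗ {N} (λ θ → trans (∣∣≡sum (active s (toℕ θ) ∩ A)) (sum-cong-≗ λ e → trans (𝟙-∩ (active s (toℕ θ)) A e) (*-comm (𝟙 (e ∈? active s (toℕ θ))) (𝟙 (e ∈? A))))) ⟩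
      sum {N} (λ θ → sum (λ e → 𝟙 (e ∈? A) * 𝟙 (e ∈? active s (toℕ θ))))      ≡⟨ ∑-comm {N} {n} (λ θ e → 𝟙 (e ∈? A) * 𝟙 (e ∈? active s (toℕ θ))) ⟩
      sum (λ e → sum {N} (λ θ → 𝟙 (e ∈? A) * 𝟙 (e ∈? active s (toℕ θ))))      ≡⟨ sum-cong-≗ (λ e → *-distribˡ-sum {N} (𝟙 (e ∈? A)) (λ θ → 𝟙 (e ∈? active s (toℕ θ)))) ⟨
      sum (λ e → 𝟙 (e ∈? A) * sum {N} (λ θ → 𝟙 (e ∈? active s (toℕ θ))))      ≡⟨ sum-cong-≗ (λ e → cong (𝟙 (e ∈? A) *_) (sum-active s e)) ⟩
      sum (λ e → 𝟙 (e ∈? A) * c e)                                            ∎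
      where
      open ≡-Reasoning

    -- The second clause is what later turns the blocked arcs beginning at `θ` into coloops of
    -- `A ∪ active s θ`: all of `A` is spanned without them.
    Covered : Subset n → State → Fin n → ℕ → Set
    Covered A s e θ = e ∈cl active s θ ×
      (∀ {b} → b ∉ A → phase s θ b ≡ 0 → 0 < c b → e ∈cl active s θ - b)

    -- k counts pushes: after k e of them, the points θ with N ≤ phase s θ e + k e
    -- are the ones that the beginning of the arc of e has passed.
    Inv : Subset n → State → (Fin n → ℕ) → Set
    Inv A s k = ∀ {e θ} → e ∈ A → N ≤ phase s θ e + k e → Covered A s e θ

    record Step (A : Subset n) (s : State) (f : Fin n) : Set where
      field
        f∈A      : f ∈ A
        pushable : Pushable s f
        blocked  : ∀ {b} → b ∉ A → ¬ Pushable s b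
    open Step

    Covered-push : ∀ {A s f e θ} → Step A s f → Covered A s e θ → Covered A (push s f) e θ
    Covered-push {A} {s} {f} {e} {θ} st (e∈cl , avoiding) = cl-push (pushable st) e∈cl , avoiding′
      where
      avoiding′ : ∀ {b} → b ∉ A → phase (push s f) θ b ≡ 0 → 0 < c b → e ∈cl active (push s f) θ - b
      avoiding′ {b} b∉A b-starts 0<cb =
        cl-push-avoiding (pushable st) b≢f (blocked st b∉A) b-starts′ 0<cb (avoiding b∉A b-starts′ 0<cb)
        where
        b≢f : b ≢ f
        b≢f refl = b∉A (f∈A st)
        b-starts′ : phase s θ b ≡ 0
        b-starts′ = trans (sym (phase-push-≢ s θ b≢f)) b-starts

    -- The only possibly new claim concerns `f` at the point that its arc leaves. There `f` was
    -- present before the push, hence covered, and coverage survives the push.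
    Inv-push : ∀ {A s f k} → Step A s f → Inv A s k → Inv A (push s f) (updateAt k f suc)
    Inv-push {A} {s} {f} {k} st inv {e} {θ} e∈A N≤ with e Fin.≟ f
    ... | no e≢f = Covered-push st
      (inv e∈A (subst (N ≤_) (cong₂ _+_ (phase-push-≢ s θ e≢f) (updateAt-minimal e f k e≢f)) N≤))
    ... | yes refl = Covered-push st covered
      where
      covered : Covered A s e θ
      covered with phase s θ e in eq
      ... | zero  = ∈⇒∈cl e∈I , λ b∉A _ _ → ∈⇒∈cl (x∈p∧x≢y⇒x∈p-y e∈I λ { refl → b∉A e∈A })
        where
        e∈I : e ∈ active s θ
        e∈I = ∈active⁺ (subst (_< c e) (sym eq) (proj₁ (pushable st)))
      ... | suc d = inv e∈A (subst (N ≤_) shift N≤)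
        where
        shift : phase (push s e) θ e + updateAt k e suc e ≡ phase s θ e + k e
        shift = trans (cong₂ _+_ (phase-push-suc s θ eq) (updateAt-updates e k))
                      (trans (+-suc d (k e)) (cong (_+ k e) (sym eq)))

    Inv-anti : ∀ {A s k k′} → (∀ e → k e ≤ k′ e) → Inv A s k′ → Inv A s k
    Inv-anti k≤k′ inv e∈A N≤ = inv e∈A (≤-trans N≤ (+-monoʳ-≤ _ (k≤k′ _)))

    k≤updateAt-suc : ∀ (k : Fin n → ℕ) f e → k e ≤ updateAt k f suc e
    k≤updateAt-suc k f e with e Fin.≟ f
    ... | yes refl = ≤-trans (n≤1+n (k e)) (≤-reflexive (sym (updateAt-updates e k)))
    ... | no e≢f   = ≤-reflexive (sym (updateAt-minimal e f k e≢f))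

    full-turn-impossible : ∀ {A s k f} → Inv A s k → (∀ {e} → e ∈ A → N ≤ k e) → ¬ Step A s f
    full-turn-impossible {A} {s} {k} {f} inv full st =
      <⇒≱ heavy (sparse (indep B) (spans B))
      where
      open ≤-Reasoning
      B = basis A
      covered : ∀ {e θ} → e ∈ A → Covered A s e θ
      covered e∈A = inv e∈A (≤-trans (full e∈A) (m≤n+m _ _))
      start-coloop : ∀ {θ b} → b ∉ A → phase s θ b ≡ 0 → 0 < c b → b ∉cl (A ∪ active s θ) - b
      start-coloop {θ} {b} b∉A b-starts 0<cb b∈cl =
        ¬pushable⇒∉cl (blocked st b∉A) b-starts 0<cb (cl-trans inside-cl b∈cl)
        where
        inside-cl : ∀ {x} → x ∈ (A ∪ active s θ) - b → x ∈cl active s θ - b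
        inside-cl x∈ with x∈p∪q⁻ A _ (p-x⊆p _ b x∈)
        ... | inj₁ x∈A = proj₂ (covered x∈A) b∉A b-starts 0<cb
        ... | inj₂ x∈I = ∈⇒∈cl (x∈p∧x≢y⇒x∈p-y x∈I (x∈p-y⇒x≢y _ x∈))
      -- The elements present from outside `A` are coloops of `A ∪ active s θ` and do not help to
      -- span elements of `A`.
      restrict : ∀ {θ Y e} → Y ⊆ active s θ → e ∈ A → e ∈cl Y → e ∈cl Y ∩ A
      restrict {θ} Y⊆I e∈A = drop-coloops {W = A ∪ active s θ} (q⊆p∪q A _ ∘ Y⊆I) (p⊆p∪q _ e∈A) (λ _ → e∈A)
        (λ x∈Y x∉A → active-coloop A s start-coloop x∉A (Y⊆I x∈Y))
      rank≤ : ∀ θ → ∣ set B ∣ ≤ ∣ active s θ ∩ A ∣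
      rank≤ θ = ≤-trans (basis-size-mono B (basis (active s θ ∩ A)) (λ e∈A → restrict id e∈A (proj₁ (covered e∈A))))
                        (p⊆q⇒∣p∣≤∣q∣ (set⊆ (basis (active s θ ∩ A))))
      θ₀ = origin s f
      f-starts : phase s (θ₀ % N) f ≡ 0
      f-starts = trans (phase-def s _ f) (trans ([x%N+y]%N m θ₀ (s f)) (origin≡0 s f))
      I₀ = active s (θ₀ % N)
      f∈I₀ : f ∈ I₀
      f∈I₀ = ∈active⁺ (subst (_< c f) (sym f-starts) (proj₁ (pushable st)))
      f∈clI₀-f : f ∈cl (I₀ - f) ∩ A
      f∈clI₀-f = restrict (p-x⊆p I₀ f) (f∈A st) (pushable⇒∈cl (pushable st) f-starts)
      A⊆cl : ∀ {e} → e ∈ A → e ∈cl (I₀ - f) ∩ A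
      A⊆cl e∈A = cl-trans back (restrict id e∈A (proj₁ (covered e∈A)))
        where
        back : ∀ {x} → x ∈ I₀ ∩ A → x ∈cl (I₀ - f) ∩ A
        back {x} x∈ with x Fin.≟ f | x∈p∩q⁻ I₀ A x∈
        ... | yes refl | _           = f∈clI₀-f
        ... | no x≢f   | x∈I₀ , x∈A = ∈⇒∈cl (x∈p∩q⁺ (x∈p∧x≢y⇒x∈p-y x∈I₀ x≢f , x∈A))
      -- Where the arc of `f` begins, the members of `A` present span `A` even without `f`, so there
      -- is one to spare.
      rank< : ∣ set B ∣ < ∣ I₀ ∩ A ∣
      rank< = ≤-<-trans (≤-trans (basis-size-mono B B′ A⊆cl) (p⊆q⇒∣p∣≤∣q∣ (set⊆ B′)))
        (p⊂q⇒∣p∣<∣q∣ ((λ x∈ → let a , b = x∈p∩q⁻ (I₀ - f) A x∈ in x∈p∩q⁺ (p-x⊆p I₀ f a , b)) ,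
                       f , x∈p∩q⁺ (f∈I₀ , f∈A st) , x∉p-x I₀ f ∘ proj₁ ∘ x∈p∩q⁻ (I₀ - f) A))
        where B′ = basis ((I₀ - f) ∩ A)
      θ₁ : Fin N
      θ₁ = fromℕ< (m%n<n θ₀ N)
      heavy : N * ∣ set B ∣ < sum (λ e → 𝟙 (e ∈? A) * c e)
      heavy = begin-strict
        N * ∣ set B ∣                              ≡⟨ sum-const N ∣ set B ∣ ⟨
        sum {N} (λ _ → ∣ set B ∣)                  <⟨ sum-mono-< {N} (rank≤ ∘ toℕ) θ₁ (subst (λ θ → ∣ set B ∣ < ∣ active s θ ∩ A ∣) (sym (Fin.toℕ-fromℕ< _)) rank<) ⟩
        sum {N} (λ θ → ∣ active s (toℕ θ) ∩ A ∣)   ≡⟨ sum-∩active s A ⟩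
        sum (λ e → 𝟙 (e ∈? A) * c e)               ∎

    Outcome : Subset n → State → Set
    Outcome A s = (∃ λ b → b ∉ A × Pushable s b) ⊎ (∀ e → ¬ Pushable s e)

    outcome? : ∀ A s → Outcome A s ⊎ ∃ (Step A s)
    outcome? A s with Fin.any? (λ b → ¬? (b ∈? A) ×-dec pushable? s b) | Fin.any? (pushable? s)
    ... | yes escape | _            = inj₁ (inj₁ escape)
    ... | no _       | no none      = inj₁ (inj₂ λ e pe → none (e , pe))
    ... | no ¬escape | yes (f , pf) = inj₂ (f , record
      { f∈A      = decidable-stable (f ∈? A) (λ f∉A → ¬escape (f , f∉A , pf))
      ; pushable = pf
      ; blocked  = λ b∉A pb → ¬escape (_ , b∉A , pb)
      })

    -- The elements of A that have not yet been pushed N times are only pushed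
    -- when no other element of A can be; so either the process stops or every
    -- element of A makes a full turn.
    settle : ∀ A → Acc _<_ ∣ A ∣ → (P : State → Set) →
             (∀ {s f} → P s → Step A s f → P (push s f)) →
             ∀ s → P s → ∃ λ s′ → P s′ × Outcome A s′
    settle A (acc rec) P closed s Ps = go (λ _ → 0) (<-wellFounded _) s Ps
        -- Before any push the invariant is vacuous, since a phase is less than `N`.
        (λ {e} {θ} _ N≤ → contradiction N≤ (<⇒≱ (subst (_< N) (sym (trans (+-identityʳ _) (phase-def s θ e))) (m%n<n (θ + s e) N))))
      where
      go : (k : Fin n → ℕ) → Acc _<_ (sum (λ e → N ∸ k e)) → ∀ s → P s → Inv A s k →
           ∃ λ s′ → P s′ × Outcome A s′
      go k (acc rec′) s Ps inv with outcome? A s | Fin.any? (λ e → (e ∈? A) ×-dec (k e <? N))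
      ... | inj₁ out     | _  = s , Ps , out
      ... | inj₂ (_ , st) | no none = contradiction st
        (full-turn-impossible inv λ {e} e∈A → ≮⇒≥ λ ke<N → none (e , e∈A , ke<N))
      -- The inner run pushes only elements that have completed a turn. Their further pushes need
      -- not be counted, as a smaller `k` claims less. `P` collects the invariants of the enclosing
      -- runs.
      ... | inj₂ _ | yes (x , x∈A , kx<N) = resume (settle A′ (rec A′<A) (λ s → P s × Inv A s k)
          (λ (Ps , inv) st → closed Ps (widen st) , Inv-anti (k≤updateAt-suc k _) (Inv-push (widen st) inv)) s (Ps , inv))
        where
        turned? : Decidable (λ e → e ∈ A × N ≤ k e)
        turned? e = (e ∈? A) ×-dec (N ≤? k e)
        A′ : Subset n
        A′ = ⟪ turned? ⟫
        A′⊆A : A′ ⊆ A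
        A′⊆A = proj₁ ∘ ∈⟪⟫⁻ turned?
        A′<A : ∣ A′ ∣ < ∣ A ∣
        A′<A = p⊂q⇒∣p∣<∣q∣ (A′⊆A , x , x∈A , λ x∈A′ → <⇒≱ kx<N (proj₂ (∈⟪⟫⁻ turned? x∈A′)))
        widen : ∀ {s f} → Step A′ s f → Step A s f
        widen st = record { f∈A = A′⊆A (f∈A st) ; pushable = pushable st ; blocked = λ b∉A → blocked st (b∉A ∘ A′⊆A) }
        resume : (∃ λ s′ → (P s′ × Inv A s′ k) × Outcome A′ s′) → ∃ λ s′ → P s′ × Outcome A s′
        resume (s′ , (Ps′ , _) , inj₂ stable) = s′ , Ps′ , inj₂ stable
        resume (s′ , (Ps′ , inv′) , inj₁ (b , b∉A′ , pb)) with outcome? A s′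
        ... | inj₁ out      = s′ , Ps′ , out
        -- Nothing outside `A` can move, so `b` lies in `A` and has not completed its turn; counting
        -- its push lowers the measure.
        ... | inj₂ (_ , st) = go (updateAt k b suc) (rec′ decrease) (push s′ b) (closed Ps′ st′) (Inv-push st′ inv′)
          where
          b∈A : b ∈ A
          b∈A = decidable-stable (b ∈? A) (λ b∉A → blocked st b∉A pb)
          st′ : Step A s′ b
          st′ = record { f∈A = b∈A ; pushable = pb ; blocked = blocked st }
          decrease : sum (λ e → N ∸ updateAt k b suc e) < sum (λ e → N ∸ k e)
          decrease = sum-mono-< (λ e → ∸-monoʳ-≤ N (k≤updateAt-suc k b e)) b
            (subst (λ x → N ∸ x < N ∸ k b) (sym (updateAt-updates b k))
              (∸-monoʳ-< (n<1+n (k b)) (≰⇒> (λ N≤kb → b∉A′ (∈⟪⟫⁺ turned? (b∈A , N≤kb))))))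

    independent-arcs : ∃ λ (s : Fin n → ℕ) → ∀ θ → ℐ ⟪ (λ e → (θ + s e) % N <? c e) ⟫
    independent-arcs with settle ⊤ (<-wellFounded _) (λ _ → Unit) (λ _ _ → tt) (λ _ → 0) tt
    ... | s , _ , inj₁ (_ , b∉⊤ , _) = contradiction ∈⊤ b∉⊤
    -- As `active` is opaque here, its independence is passed on through an inclusion.
    ... | s , _ , inj₂ stable = s , λ θ → hereditary (λ {e} e∈ → ∈active⁺ (subst (_< c e) (sym (phase-def s θ e)) (∈⟪⟫⁻ (λ e → (θ + s e) % N <? c e) e∈))) (stable⇒ℐ stable θ)

  -- Rotation by a quotient of Fibonacci numbers.

  fib : ℕ → ℕ
  fib zero          = 1
  fib (suc zero)    = 1
  fib (suc (suc n)) = fib (suc n) + fib n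

  1≤fib : ∀ n → 1 ≤ fib n
  1≤fib zero          = ≤-refl
  1≤fib (suc zero)    = ≤-refl
  1≤fib (suc (suc n)) = ≤-trans (1≤fib (suc n)) (m≤m+n _ _)

  n≤fib : ∀ n → n ≤ fib n
  n≤fib zero          = z≤n
  n≤fib (suc zero)    = ≤-refl
  n≤fib (suc (suc n)) = subst (_≤ fib (suc n) + fib n) (+-comm (suc n) 1) (+-mono-≤ (n≤fib (suc n)) (1≤fib n))

  module Rotation (m s : ℕ) where
    N : ℕ
    N = suc m

    -- d days of rotation move every point forwards, respectively backwards, by x.
    record Forward (d x : ℕ) : Set where
      constructor forward
      field turns : ℕ
            eq    : d * s ≡ turns * N + x

    record Backward (d x : ℕ) : Set where
      constructor backward
      field turns : ℕ
            eq    : d * s + x ≡ turns * N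

    -- This and the next lemma are the subtractive steps of Euclid's algorithm on the two moves.
    forward-backward : ∀ {U V u v} → Forward U u → Backward V (v + u) → Backward (U + V) v
    forward-backward {U} {V} {u} {v} (forward q eq) (backward q′ eq′) = backward (q + q′) (begin
      (U + V) * s + v           ≡⟨ solve 4 (λ U V s v → (U :+ V) :* s :+ v := U :* s :+ (V :* s :+ v)) refl U V s v ⟩
      U * s + (V * s + v)       ≡⟨ cong (_+ (V * s + v)) eq ⟩
      q * N + u + (V * s + v)   ≡⟨ solve 4 (λ x u y v → x :+ u :+ (y :+ v) := x :+ (y :+ (v :+ u))) refl (q * N) u (V * s) v ⟩
      q * N + (V * s + (v + u)) ≡⟨ cong (q * N +_) eq′ ⟩
      q * N + q′ * N            ≡⟨ *-distribʳ-+ N q q′ ⟨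
      (q + q′) * N              ∎)
      where
      open ≡-Reasoning
      open +-*-Solver

    backward-forward : ∀ {U V u v} → Backward V v → Forward U (u + v) → Forward (V + U) u
    backward-forward {U} {V} {u} {v} (backward q eq) (forward q′ eq′) = forward (q′ + q) (begin
      (V + U) * s              ≡⟨ *-distribʳ-+ s V U ⟩
      V * s + U * s            ≡⟨ cong (V * s +_) eq′ ⟩
      V * s + (q′ * N + (u + v)) ≡⟨ solve 4 (λ x y u v → x :+ (y :+ (u :+ v)) := y :+ (x :+ v) :+ u) refl (V * s) (q′ * N) u v ⟩
      q′ * N + (V * s + v) + u ≡⟨ cong (λ x → q′ * N + x + u) eq ⟩
      q′ * N + q * N + u       ≡⟨ cong (_+ u) (*-distribʳ-+ N q′ q) ⟨
      (q′ + q) * N + u         ∎)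
      where
      open ≡-Reasoning
      open +-*-Solver

    forward-% : ∀ {U u} x → Forward U u → x % N + u < N → (x + U * s) % N ≡ x % N + u
    forward-% {U} {u} x (forward q eq) lt = begin
      (x + U * s) % N           ≡⟨ [x%N+y]%N m x (U * s) ⟨
      (x % N + U * s) % N       ≡⟨ cong (λ y → (x % N + y) % N) (trans eq (+-comm (q * N) u)) ⟩
      (x % N + (u + q * N)) % N ≡⟨ cong (_% N) (+-assoc (x % N) u (q * N)) ⟨
      (x % N + u + q * N) % N   ≡⟨ [m+kn]%n≡m%n (x % N + u) q N ⟩
      (x % N + u) % N           ≡⟨ m<n⇒m%n≡m lt ⟩
      x % N + u                 ∎
      where open ≡-Reasoning

    backward-% : ∀ {V v} x → Backward V v → v ≤ x % N → (x + V * s) % N ≡ x % N ∸ v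
    backward-% {V} {v} x (backward q eq) v≤ = begin
      (x + V * s) % N               ≡⟨ [x%N+y]%N m x (V * s) ⟨
      (x % N + V * s) % N           ≡⟨ cong (λ y → (y + V * s) % N) (m∸n+n≡m v≤) ⟨
      (x % N ∸ v + v + V * s) % N   ≡⟨ cong (_% N) (trans (+-assoc (x % N ∸ v) v (V * s)) (cong (x % N ∸ v +_) (trans (+-comm v (V * s)) eq))) ⟩
      (x % N ∸ v + q * N) % N       ≡⟨ [m+kn]%n≡m%n (x % N ∸ v) q N ⟩
      (x % N ∸ v) % N               ≡⟨ m<n⇒m%n≡m (≤-<-trans (m∸n≤m (x % N) v) (m%n<n x N)) ⟩
      x % N ∸ v                     ∎
      where open ≡-Reasoning

    module _ (a c : ℕ) where
      record Hit (t : ℕ) : Set where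
        constructor hits
        field inside-arc : (t * s + a) % N < c

      later : ∀ t d → (t + d) * s + a ≡ t * s + a + d * s
      later t d = solve 4 (λ t d s a → (t :+ d) :* s :+ a := t :* s :+ a :+ d :* s) refl t d s a
        where open +-*-Solver

      module _ {U V u v : ℕ} (fwd : Forward U u) (bwd : Backward V v) (u+v≤c : u + v ≤ c) (c≤N : c ≤ N) where

        -- From a position below `c - u` the move forwards stays in the arc. Any other position is
        -- at least `v`, because `u + v ≤ c`, so the move backwards does.
        return : ∀ {t} → 0 < U → 0 < V → Hit t → ∃ λ d → d < U ⊔ V × Hit (t + suc d)
        return {t} (s≤s {n = U′} _) (s≤s {n = V′} _) (hits hit) with (t * s + a) % N + u <? c
        ... | yes p+u<c = U′ , m≤m⊔n U V , hits (subst (_< c)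
          (sym (trans (cong (_% N) (later t U)) (forward-% (t * s + a) fwd (<-≤-trans p+u<c c≤N)))) p+u<c)
        ... | no  p+u≮c = V′ , m≤n⊔m U V , hits (subst (_< c)
          (sym (trans (cong (_% N) (later t V)) (backward-% (t * s + a) bwd v≤p))) (≤-<-trans (m∸n≤m _ v) hit))
          where
          v≤p : v ≤ (t * s + a) % N
          v≤p = +-cancelʳ-≤ u _ _ (≤-trans (≤-reflexive (+-comm v u)) (≤-trans u+v≤c (≮⇒≥ p+u≮c)))

        -- Moves backwards by `v` cannot jump over the arc, as `v ≤ c`.
        ∃hit : 0 < v → ∃ Hit
        ∃hit 0<v = go 0 (<-wellFounded _)
          where
          go : ∀ t → Acc _<_ ((t * s + a) % N) → ∃ Hit
          go t (acc rec) with (t * s + a) % N <? c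
          ... | yes hit = t , hits hit
          ... | no ¬hit = go (t + V) (rec (subst (_< (t * s + a) % N) (sym moved) (∸-monoʳ-< 0<v v≤p)))
            where
            v≤p : v ≤ (t * s + a) % N
            v≤p = ≤-trans (≤-trans (m≤n+m v u) u+v≤c) (≮⇒≥ ¬hit)
            moved : ((t + V) * s + a) % N ≡ (t * s + a) % N ∸ v
            moved = trans (cong (_% N) (later t V)) (backward-% (t * s + a) bwd v≤p)

        -- As `k` grows, the wait drops by one each day, and after a hit `return` renews it.
        recurrent : 0 < U → 0 < V → ∀ {t₀} → Hit t₀ → ∀ k → ∃ λ d → d < U ⊔ V × Hit (t₀ + k + d)
        recurrent 0<U 0<V {t₀} hit zero = 0 , <-≤-trans 0<U (m≤m⊔n U V) ,
          subst Hit (sym (trans (+-identityʳ _) (+-identityʳ t₀))) hit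
        recurrent 0<U 0<V {t₀} hit (suc k) with recurrent 0<U 0<V hit k
        ... | suc d , d<G , hit′ = d , <-trans (n<1+n d) d<G ,
          subst Hit (trans (+-suc (t₀ + k) d) (cong (_+ d) (sym (+-suc t₀ k)))) hit′
        ... | zero , _ , hit′ with return 0<U 0<V hit′
        ...   | d , d<G , hit″ = d , d<G , subst Hit eq hit″
          where
          eq : t₀ + k + 0 + suc d ≡ t₀ + suc k + d
          eq = solve 3 (λ t₀ k d → t₀ :+ k :+ con 0 :+ (con 1 :+ d) := t₀ :+ (con 1 :+ k) :+ d) refl t₀ k d
            where open +-*-Solver

    -- The invariant U v + V u ≡ N, together with V ≤ U and u ≤ v, gives
    -- (U + V) (u + v) ≤ 2 N: the first stage whose moves fit into an arc is reached
    -- before the return times get too long for it.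
    search : ∀ (Q c b : ℕ) → Q + Q ≤ c → (R S : ℕ → ℕ → Set) →
             (∀ {U V u v} → R U u → S V (v + u) → S (U + V) v) →
             (∀ {U V u v} → S V v → R U (u + v) → R (V + U) u) →
             ∀ {U V} → 0 < V → V ≤ U → R U (Q * fib b) → S V (Q * fib (suc b)) →
             U * (Q * fib (suc b)) + V * (Q * fib b) ≡ N → c * U < 2 * N →
             ∃₂ λ U V → ∃₂ λ u v → R U u × S V v × u + v ≤ c × 0 < U × 0 < V × c * U < 2 * N × c * V < 2 * N × Q ≤ u × Q ≤ v
    search Q c b 2Q≤c R S RS SR {U} {V} 0<V V≤U r s cons cU<2N with Q * fib b + Q * fib (suc b) ≤? c
    ... | yes u+v≤c = U , V , Q * fib b , Q * fib (suc b) , r , s , u+v≤c , <-≤-trans 0<V V≤U , 0<V , cU<2N ,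
      ≤-<-trans (*-monoʳ-≤ c V≤U) cU<2N , Q≤ b , Q≤ (suc b)
      where
      Q≤ : ∀ b → Q ≤ Q * fib b
      Q≤ b = ≤-trans (≤-reflexive (sym (*-identityʳ Q))) (*-monoʳ-≤ Q (1≤fib b))
    -- Here both moves have length `Q`, so they fit.
    search Q c zero 2Q≤c R S RS SR _ _ _ _ _ _ | no ¬p =
      contradiction (subst (λ x → x + x ≤ c) (sym (*-identityʳ Q)) 2Q≤c) ¬p
    search Q c (suc b) 2Q≤c R S RS SR {U} {V} 0<V V≤U r s cons cU<2N | no ¬p
      -- The longer move `w + u` is cut down to `w` and becomes the shorter one. So the two
      -- directions change roles, which is why `R` and `S` are abstract.
      with search Q c b 2Q≤c S R SR RS (<-≤-trans 0<V V≤U) (m≤m+n U V) (RS r (subst (S V) split s)) r cons′ c[U+V]<2N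
      where
      u = Q * fib (suc b)
      w = Q * fib b
      split : Q * (fib (suc b) + fib b) ≡ w + u
      split = trans (*-distribˡ-+ Q (fib (suc b)) (fib b)) (+-comm u w)
      cons₀ : U * (w + u) + V * u ≡ N
      cons₀ = trans (cong (λ x → U * x + V * u) (sym split)) cons
      cons′ : (U + V) * u + U * w ≡ N
      cons′ = trans (solve 4 (λ U V u w → (U :+ V) :* u :+ U :* w := U :* (w :+ u) :+ V :* u) refl U V u w) cons₀
        where open +-*-Solver
      c[U+V]<2N : c * (U + V) < 2 * N
      c[U+V]<2N = begin-strict
        c * (U + V)                        <⟨ *-monoˡ-< (U + V) {{ℕ.>-nonZero (≤-trans 0<V (m≤n+m V U))}} (≰⇒> ¬p) ⟩
        (u + Q * (fib (suc b) + fib b)) * (U + V) ≡⟨ cong (λ x → (u + x) * (U + V)) split ⟩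
        (u + (w + u)) * (U + V)            ≡⟨ cong (λ x → (u + (w + u)) * (x + V)) (m∸n+n≡m V≤U) ⟨
        -- With `v = w + u`, the slack `α * w` is `(U - V) (v - u)`, which is exactly
        -- `2 N - (U + V) (u + v)`.
        (u + (w + u)) * (α + V + V)        ≤⟨ m≤m+n _ (α * w) ⟩
        (u + (w + u)) * (α + V + V) + α * w ≡⟨ solve 4 (λ α V u w → (u :+ (w :+ u)) :* (α :+ V :+ V) :+ α :* w := con 2 :* ((α :+ V) :* (w :+ u) :+ V :* u)) refl α V u w ⟩
        2 * ((α + V) * (w + u) + V * u)    ≡⟨ cong (λ x → 2 * (x * (w + u) + V * u)) (m∸n+n≡m V≤U) ⟩
        2 * (U * (w + u) + V * u)          ≡⟨ cong (2 *_) cons₀ ⟩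
        2 * N                              ∎
        where
        open ≤-Reasoning
        open +-*-Solver
        α = U ∸ V
    ... | U′ , V′ , u′ , v′ , s′ , r′ , le , 0<U′ , 0<V′ , cU′ , cV′ , Q≤u , Q≤v =
      V′ , U′ , v′ , u′ , r′ , s′ , ≤-trans (≤-reflexive (+-comm v′ u′)) le , 0<V′ , 0<U′ , cV′ , cU′ , Q≤v , Q≤u

    frequent-hits : ∀ (Q b : ℕ) → 0 < Q → s ≡ Q * fib b → N ≡ Q * fib (suc (suc b)) →
                    ∀ (a c : ℕ) → Q + Q ≤ c → c ≤ N →
                    ∃₂ λ t₀ G → c * G < 2 * N × (∀ k → ∃ λ d → d < G × Hit a c (t₀ + k + d))
    frequent-hits Q b 0<Q s≡ N≡ a c 2Q≤c c≤N =
      let U , V , u , v , fwd , bwd , u+v≤c , 0<U , 0<V , cU<2N , cV<2N , _ , Q≤v =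
            search Q c b 2Q≤c Forward Backward forward-backward backward-forward (s≤s z≤n) ≤-refl
              -- One day moves by `s` forwards and equally by `N - s` backwards; the search starts
              -- from `U = V = 1`.
              (forward 0 (trans (*-identityˡ s) s≡))
              (backward 1 (trans (cong (_+ Q * fib (suc b)) (trans (*-identityˡ s) s≡)) (trans sum≡N (sym (*-identityˡ N)))))
              (trans (cong₂ _+_ (*-identityˡ (Q * fib (suc b))) (*-identityˡ (Q * fib b))) (trans (+-comm (Q * fib (suc b)) _) sum≡N))
              (subst (_< 2 * N) (sym (*-identityʳ c)) (≤-<-trans c≤N (m<m+n N (s≤s z≤n))))
          t₀ , hit = ∃hit a c fwd bwd u+v≤c c≤N (<-≤-trans 0<Q Q≤v)
      in t₀ , U ⊔ V , subst (_< 2 * N) (sym (*-distribˡ-⊔ c U V)) (⊔-lub cU<2N cV<2N) ,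
         recurrent a c fwd bwd u+v≤c c≤N 0<U 0<V hit
      where
      sum≡N : Q * fib b + Q * fib (suc b) ≡ N
      sum≡N = trans (+-comm (Q * fib b) _) (trans (sym (*-distribˡ-+ Q (fib (suc b)) (fib b))) (sym N≡))

open Discrete

-- Rational numbers and common denominators.

open import Data.Integer as ℤ using (+_; -[1+_])
import Data.Integer.Properties as ℤ
open import Data.Rational as ℚ using (ℚ; mkℚ; 0ℚ; 1ℚ; _+_; _*_; _≤_; _<_; _/_)
import Data.Rational.Properties as ℚ
open import Data.Rational.Unnormalised using (*≡*)
import Data.Rational.Unnormalised.Properties as ℚᵘ
open import Data.List.Extrema (DecTotalOrder.totalOrder ℚ.≤-decTotalOrder) using (max; max<v⁺)

module ℕ∑ = Sum ℕ.+-*-semiring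
module ℚ∑ = Sum (CommutativeRing.semiring ℚ.+-*-commutativeRing)

-- Opaque, because products of transparent values would unfold to symbolic gcds.
opaque
  ι : ℕ → ℚ
  ι k = mkℚ (+ k) 0 (ℕ.sym (ℕ.1-coprimeTo k))

  ι-+ : ∀ a b → ι (a ℕ.+ b) ≡ ι a + ι b
  ι-+ a b = ℚ.toℚᵘ-injective (ℚᵘ.≃-trans
    (*≡* (cong (ℤ._* + 1) (sym (cong₂ ℤ._+_ (ℤ.*-identityʳ (+ a)) (ℤ.*-identityʳ (+ b))))))
    (ℚᵘ.≃-sym (ℚ.toℚᵘ-homo-+ (ι a) (ι b))))

  ι-* : ∀ a b → ι (a ℕ.* b) ≡ ι a * ι b
  ι-* a b = ℚ.toℚᵘ-injective (ℚᵘ.≃-trans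
    (*≡* (cong (ℤ._* + 1) (ℤ.pos-* a b)))
    (ℚᵘ.≃-sym (ℚ.toℚᵘ-homo-* (ι a) (ι b))))

  ι-mono-≤ : ∀ {a b} → a ℕ.≤ b → ι a ≤ ι b
  ι-mono-≤ {a} {b} a≤b = ℚ.*≤* (ℤ.*-monoʳ-≤-nonNeg (+ 1) (ℤ.+≤+ a≤b))

  ι-cancel-≤ : ∀ {a b} → ι a ≤ ι b → a ℕ.≤ b
  ι-cancel-≤ {a} {b} (ℚ.*≤* le) = ℤ.drop‿+≤+ (ℤ.*-cancelʳ-≤-pos (+ a) (+ b) (+ 1) le)

  ι-mono-< : ∀ {a b} → a ℕ.< b → ι a < ι b
  ι-mono-< {a} {b} a<b = ℚ.*<* (ℤ.*-monoʳ-<-pos (+ 1) (ℤ.+<+ a<b))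

  ι-nonNeg : ∀ a → ℚ.NonNegative (ι a)
  ι-nonNeg a = _

  ι-0 : ι 0 ≡ 0ℚ
  ι-0 = refl

  ι-1 : ι 1 ≡ 1ℚ
  ι-1 = refl

  ι-2 : ι 2 ≡ + 2 ℚ./ 1
  ι-2 = refl

  nonNeg-numerator : ∀ {q} → 0ℚ ≤ q → ∃₂ λ d a → 0 ℕ.< d × ι d * q ≡ ι a
  nonNeg-numerator {q@(mkℚ (+ a) d-1 _)} _ = suc d-1 , a , s≤s z≤n , ℚ.toℚᵘ-injective (ℚᵘ.≃-trans
    (ℚ.toℚᵘ-homo-* (ι (suc d-1)) q)
    (*≡* (trans (ℤ.*-identityʳ _) (trans (ℤ.*-comm (+ suc d-1) (+ a)) (cong (λ x → + a ℤ.* + suc x) (sym (ℕ.+-identityʳ d-1)))))))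
  nonNeg-numerator {q@(mkℚ (-[1+ a ]) d-1 _)} 0≤q = contradiction (ℚ.<-≤-trans (ℚ.negative⁻¹ q) 0≤q) (ℚ.<-irrefl refl)

instance
  ι-nonNegative : ∀ {a} → ℚ.NonNegative (ι a)
  ι-nonNegative {a} = ι-nonNeg a

ι-1-* : ∀ q → ι 1 * q ≡ q
ι-1-* q = trans (cong (_* q) ι-1) (ℚ.*-identityˡ q)

ι-sum : ∀ {n} (f : Fin n → ℕ) → ι (ℕ∑.sum f) ≡ ℚ∑.sum (ι ∘ f)
ι-sum {zero}  f = ι-0
ι-sum {suc n} f = trans (ι-+ (f zero) _) (cong (λ y → ι (f zero) + y) (ι-sum (f ∘ suc)))

common-denominator : ∀ {n} (g : Fin n → ℚ) → (∀ e → 0ℚ ≤ g e) →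
                     ∃₂ λ Q (p : Fin n → ℕ) → 0 ℕ.< Q × (∀ e → ι Q * g e ≡ ι (p e))
common-denominator {zero} g g≥0 = 1 , (λ ()) , s≤s z≤n , λ ()
common-denominator {suc n} g g≥0
  with Q , p , 0<Q , eq ← common-denominator (g ∘ suc) (g≥0 ∘ suc)
     | d , a , 0<d , eq₀ ← nonNeg-numerator (g≥0 zero) =
  Q ℕ.* d , p′ , ℕ.*-mono-< 0<Q 0<d , eq′
  where
  p′ : Fin (suc n) → ℕ
  p′ zero    = Q ℕ.* a
  p′ (suc e) = d ℕ.* p e
  open ≡-Reasoning
  eq′ : ∀ e → ι (Q ℕ.* d) * g e ≡ ι (p′ e)
  eq′ zero = begin
    ι (Q ℕ.* d) * g zero  ≡⟨ cong (_* g zero) (ι-* Q d) ⟩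
    ι Q * ι d * g zero    ≡⟨ ℚ.*-assoc (ι Q) (ι d) (g zero) ⟩
    ι Q * (ι d * g zero)  ≡⟨ cong (ι Q *_) eq₀ ⟩
    ι Q * ι a             ≡⟨ ι-* Q a ⟨
    ι (Q ℕ.* a)           ∎
  eq′ (suc e) = begin
    ι (Q ℕ.* d) * g (suc e)  ≡⟨ cong (λ x → ι x * g (suc e)) (ℕ.*-comm Q d) ⟩
    ι (d ℕ.* Q) * g (suc e)  ≡⟨ cong (_* g (suc e)) (ι-* d Q) ⟩
    ι d * ι Q * g (suc e)    ≡⟨ ℚ.*-assoc (ι d) (ι Q) (g (suc e)) ⟩
    ι d * (ι Q * g (suc e))  ≡⟨ cong (ι d *_) (eq e) ⟩
    ι d * ι (p e)            ≡⟨ ι-* d (p e) ⟨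
    ι (d ℕ.* p e)            ∎

-- Sparsity of the growth rates.

module _ {n : ℕ} (C : CBGT n) (M : IsMatroid (CBGT.ℐ C)) where
  open CBGT C
  open IsMatroid M
  open Closure ℐ? M

  private
    coeff = proj₁ convex

    growth : List (Subset n) → Fin n → ℚ
    growth L e = ∑ (List.map coeff (filter (λ I → ℐ? I ×-dec (e ∈? I)) L))

    total : List (Subset n) → ℚ
    total L = ∑ (List.map coeff (filter ℐ? L))

    growth-reject : ∀ {I} L → ¬ ℐ I → ∀ e → growth (I ∷ L) e ≡ growth L e
    growth-reject L ¬ℐI e = cong (∑ ∘ List.map coeff) (filter-reject (λ I → ℐ? I ×-dec (e ∈? I)) (¬ℐI ∘ proj₁))

    growth-accept : ∀ {I} L → ℐ I → ∀ e → growth (I ∷ L) e ≡ ι (𝟙 (e ∈? I)) * coeff I + growth L e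
    growth-accept {I} L ℐI e = go (e ∈? I)
      where
      go : (e∈?I : Dec (e ∈ I)) → growth (I ∷ L) e ≡ ι (𝟙 e∈?I) * coeff I + growth L e
      go (yes e∈I) = trans (cong (∑ ∘ List.map coeff) (filter-accept (λ I → ℐ? I ×-dec (e ∈? I)) (ℐI , e∈I)))
                           (cong (_+ growth L e) (sym (ι-1-* (coeff I))))
      go (no e∉I)  = trans (cong (∑ ∘ List.map coeff) (filter-reject (λ I → ℐ? I ×-dec (e ∈? I)) (e∉I ∘ proj₂)))
                           (sym (trans (cong (_+ growth L e) (trans (cong (_* coeff I) ι-0) (ℚ.*-zeroˡ (coeff I)))) (ℚ.+-identityˡ _)))

  -- Each independent `I` contributes `coeff I` times the size of `A ∩ I`, an independent set
  -- spanned by `J` and so no larger than `J`.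
  weighted-growth≤ : ∀ {A J} → ℐ J → (∀ {e} → e ∈ A → Spans J e) → ∀ L →
                     ℚ∑.sum (λ e → ι (𝟙 (e ∈? A)) * growth L e) ≤ total L * ι (∣ J ∣)
  weighted-growth≤ {A} {J} ℐJ sp [] = ℚ.≤-reflexive (begin
    ℚ∑.sum (λ e → ι (𝟙 (e ∈? A)) * 0ℚ)  ≡⟨ ℚ∑.*-distribʳ-sum 0ℚ (λ e → ι (𝟙 (e ∈? A))) ⟨
    ℚ∑.sum (λ e → ι (𝟙 (e ∈? A))) * 0ℚ  ≡⟨ ℚ.*-zeroʳ (ℚ∑.sum (λ e → ι (𝟙 (e ∈? A)))) ⟩
    0ℚ                                  ≡⟨ ℚ.*-zeroˡ (ι (∣ J ∣)) ⟨
    0ℚ * ι (∣ J ∣)                        ∎)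
    where open ≡-Reasoning
  weighted-growth≤ {A} {J} ℐJ sp (I ∷ L) = step (ℐ? I)
    where
    open ℚ.≤-Reasoning
    λI = coeff I
    step : Dec (ℐ I) → ℚ∑.sum (λ e → ι (𝟙 (e ∈? A)) * growth (I ∷ L) e) ≤ total (I ∷ L) * ι (∣ J ∣)
    step (no ¬ℐI) = begin
      ℚ∑.sum (λ e → ι (𝟙 (e ∈? A)) * growth (I ∷ L) e) ≡⟨ ℚ∑.sum-cong-≗ (λ e → cong (ι (𝟙 (e ∈? A)) *_) (growth-reject L ¬ℐI e)) ⟩
      ℚ∑.sum (λ e → ι (𝟙 (e ∈? A)) * growth L e)       ≤⟨ weighted-growth≤ ℐJ sp L ⟩
      total L * ι (∣ J ∣)                              ≡⟨ cong (λ K → ∑ (List.map coeff K) * ι (∣ J ∣)) (filter-reject ℐ? ¬ℐI) ⟨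
      total (I ∷ L) * ι (∣ J ∣)                        ∎
    step (yes ℐI) = begin
      ℚ∑.sum (λ e → ι (𝟙 (e ∈? A)) * growth (I ∷ L) e)
        ≡⟨ ℚ∑.sum-cong-≗ split ⟩
      ℚ∑.sum (λ e → λI * ι (𝟙 (e ∈? A ∩ I)) + ι (𝟙 (e ∈? A)) * growth L e)
        ≡⟨ ℚ∑.∑-distrib-+ (λ e → λI * ι (𝟙 (e ∈? A ∩ I))) _ ⟩
      ℚ∑.sum (λ e → λI * ι (𝟙 (e ∈? A ∩ I))) + ℚ∑.sum (λ e → ι (𝟙 (e ∈? A)) * growth L e)
        ≡⟨ cong (_+ ℚ∑.sum (λ e → ι (𝟙 (e ∈? A)) * growth L e)) (trans (sym (ℚ∑.*-distribˡ-sum λI (λ e → ι (𝟙 (e ∈? A ∩ I)))))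
                (cong (λI *_) (trans (sym (ι-sum (λ e → 𝟙 (e ∈? A ∩ I)))) (cong ι (sym (∣∣≡sum (A ∩ I))))))) ⟩
      λI * ι (∣ A ∩ I ∣) + ℚ∑.sum (λ e → ι (𝟙 (e ∈? A)) * growth L e)
        ≤⟨ ℚ.+-mono-≤ (ℚ.*-monoˡ-≤-nonNeg λI {{ℚ.nonNegative (proj₁ (proj₂ convex) I ℐI)}} (ι-mono-≤ A∩I≤J)) (weighted-growth≤ ℐJ sp L) ⟩
      λI * ι (∣ J ∣) + total L * ι (∣ J ∣)
        ≡⟨ ℚ.*-distribʳ-+ (ι (∣ J ∣)) λI (total L) ⟨
      (λI + total L) * ι (∣ J ∣)
        ≡⟨ cong (λ K → ∑ (List.map coeff K) * ι (∣ J ∣)) (filter-accept ℐ? ℐI) ⟨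
      total (I ∷ L) * ι (∣ J ∣) ∎
      where
      A∩I≤J : ∣ A ∩ I ∣ ℕ.≤ ∣ J ∣
      A∩I≤J = spanned⇒∣∣≤ ℐJ (hereditary (p∩q⊆q A I) ℐI) (sp ∘ p∩q⊆p A I)
      split : ∀ e → ι (𝟙 (e ∈? A)) * growth (I ∷ L) e ≡
                    λI * ι (𝟙 (e ∈? A ∩ I)) + ι (𝟙 (e ∈? A)) * growth L e
      split e = begin-equality
        x * growth (I ∷ L) e             ≡⟨ cong (x *_) (growth-accept L ℐI e) ⟩
        x * (y * λI + growth L e)        ≡⟨ ℚ.*-distribˡ-+ x (y * λI) (growth L e) ⟩
        x * (y * λI) + x * growth L e    ≡⟨ cong (_+ x * growth L e) (trans (sym (ℚ.*-assoc x y λI)) (trans (ℚ.*-comm (x * y) λI)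
                                              (cong (λI *_) (trans (sym (ι-* (𝟙 (e ∈? A)) (𝟙 (e ∈? I)))) (cong ι (sym (𝟙-∩ A I e))))))) ⟩
        λI * ι (𝟙 (e ∈? A ∩ I)) + x * growth L e ∎
        where
        x = ι (𝟙 (e ∈? A))
        y = ι (𝟙 (e ∈? I))

  g-sparse : ∀ {N} (c : Fin n → ℕ) → (∀ e → ι N * g e ≡ ι (c e)) → ∀ {A J} → ℐ J → (∀ {e} → e ∈ A → Spans J e) →
             ℕ∑.sum (λ e → 𝟙 (e ∈? A) ℕ.* c e) ℕ.≤ N ℕ.* ∣ J ∣
  g-sparse {N} c Ng≡c {A} {J} ℐJ sp = ι-cancel-≤ (begin
    ι (ℕ∑.sum (λ e → 𝟙 (e ∈? A) ℕ.* c e))           ≡⟨ ι-sum (λ e → 𝟙 (e ∈? A) ℕ.* c e) ⟩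
    ℚ∑.sum (λ e → ι (𝟙 (e ∈? A) ℕ.* c e))           ≡⟨ ℚ∑.sum-cong-≗ scale ⟩
    ℚ∑.sum (λ e → ι N * (ι (𝟙 (e ∈? A)) * growth (subsets n) e)) ≡⟨ ℚ∑.*-distribˡ-sum (ι N) (λ e → ι (𝟙 (e ∈? A)) * growth (subsets n) e) ⟨
    ι N * ℚ∑.sum (λ e → ι (𝟙 (e ∈? A)) * growth (subsets n) e)   ≤⟨ ℚ.*-monoˡ-≤-nonNeg (ι N) (weighted-growth≤ ℐJ sp (subsets n)) ⟩
    ι N * (total (subsets n) * ι (∣ J ∣))             ≡⟨ cong (λ z → ι N * (z * ι (∣ J ∣))) (proj₁ (proj₂ (proj₂ convex))) ⟩
    ι N * (1ℚ * ι (∣ J ∣))                            ≡⟨ cong (ι N *_) (ℚ.*-identityˡ (ι (∣ J ∣))) ⟩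
    ι N * ι (∣ J ∣)                                   ≡⟨ ι-* N ∣ J ∣ ⟨
    ι (N ℕ.* ∣ J ∣)                                 ∎)
    where
    open ℚ.≤-Reasoning
    scale : ∀ e → ι (𝟙 (e ∈? A) ℕ.* c e) ≡ ι N * (ι (𝟙 (e ∈? A)) * growth (subsets n) e)
    scale e = begin-equality
      ι (𝟙 (e ∈? A) ℕ.* c e)              ≡⟨ ι-* (𝟙 (e ∈? A)) (c e) ⟩
      x * ι (c e)                         ≡⟨ cong (x *_) (Ng≡c e) ⟨
      x * (ι N * g e)                     ≡⟨ ℚ.*-assoc x (ι N) (g e) ⟨
      x * ι N * g e                       ≡⟨ cong (_* g e) (ℚ.*-comm x (ι N)) ⟩
      ι N * x * g e                       ≡⟨ ℚ.*-assoc (ι N) x (g e) ⟩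
      ι N * (x * g e)                     ≡⟨ cong (λ z → ι N * (x * z)) (proj₂ (proj₂ (proj₂ convex)) e) ⟩
      ι N * (x * growth (subsets n) e)    ∎
      where x = ι (𝟙 (e ∈? A))

-- Heights and their suprema.

argmax-below : ∀ (f : ℕ → ℚ) n → ∃ λ t₀ → ∀ t → t ℕ.< suc n → f t ≤ f t₀
argmax-below f zero = 0 , λ where zero _ → ℚ.≤-refl
                                  (suc t) (s≤s ())
argmax-below f (suc n) with argmax-below f n
... | t₀ , f≤ with ℚ.≤-total (f t₀) (f (suc n))
...   | inj₁ le = suc n , bound
  where
  bound : ∀ t → t ℕ.< suc (suc n) → f t ≤ f (suc n)
  bound t t<ssn with ℕ.m<1+n⇒m<n∨m≡n t<ssn
  ... | inj₁ t<sn = ℚ.≤-trans (f≤ t t<sn) le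
  ... | inj₂ refl = ℚ.≤-refl
...   | inj₂ ge = t₀ , bound
  where
  bound : ∀ t → t ℕ.< suc (suc n) → f t ≤ f t₀
  bound t t<ssn with ℕ.m<1+n⇒m<n∨m≡n t<ssn
  ... | inj₁ t<sn = f≤ t t<sn
  ... | inj₂ refl = ge

-- Supplies a rational supremum: it is attained among the first `T + m + 1` values, the part before
-- the period and one period.
eventually-periodic-sup : ∀ (f : ℕ → ℚ) T m → (∀ k → f (T ℕ.+ k ℕ.+ suc m) ≡ f (T ℕ.+ k)) →
                          ∃ λ t → IsSup f (f t)
eventually-periodic-sup f T m periodic with argmax-below f (T ℕ.+ m)
... | t₀ , f≤ = t₀ , (λ t → bound t (<-wellFounded t)) , λ b f≤b → f≤b t₀
  where
  bound : ∀ t → Acc ℕ._<_ t → f t ≤ f t₀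
  bound t (acc rec) with t ℕ.<? suc (T ℕ.+ m)
  ... | yes t< = f≤ t t<
  ... | no t≮ = subst (_≤ f t₀) (sym f≡) (bound (T ℕ.+ k) (rec (subst (T ℕ.+ k ℕ.<_) (sym t≡) (ℕ.m<m+n (T ℕ.+ k) (s≤s z≤n)))))
    where
    k = t ℕ.∸ suc (T ℕ.+ m)
    t≡ : t ≡ T ℕ.+ k ℕ.+ suc m
    t≡ = trans (sym (ℕ.m∸n+n≡m (ℕ.≮⇒≥ t≮))) (solve 3 (λ k T m → k :+ (con 1 :+ (T :+ m)) := T :+ k :+ (con 1 :+ m)) refl k T m)
      where open +-*-Solver
    f≡ : f t ≡ f (T ℕ.+ k)
    f≡ = trans (cong f t≡) (periodic k)

module Heights {n : ℕ} (C : CBGT n) (π : Schedule n) (e : Fin n) where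
  open CBGT C

  height : ℕ → ℚ
  height t = heightOn C π t e

  height-cut : ∀ {t} → e ∈ π t → height (suc t) ≡ g e
  height-cut {t} e∈ rewrite dec-true (e ∈? π t) e∈ = refl

  -- Reduces bounds on heights to bounds on the number of successive days without a cut.
  height-age : ∀ t → ∃ λ j → j ℕ.≤ t × height t ≡ ι (suc j) * g e × (∀ i → t ℕ.∸ j ℕ.≤ i → i ℕ.< t → e ∉ π i)
  height-age zero = 0 , z≤n , sym (ι-1-* (g e)) , λ _ _ ()
  height-age (suc t) with e ∈? π t
  ... | yes e∈ = 0 , z≤n , sym (ι-1-* (g e)) , λ i t<i i<st → contradiction t<i (ℕ.<⇒≱ i<st)
  ... | no e∉ with j , j≤t , eq , uncut ← height-age t = suc j , s≤s j≤t , eq′ , uncut′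
    where
    open ≡-Reasoning
    eq′ : height t + g e ≡ ι (suc (suc j)) * g e
    eq′ = begin
      height t + g e                ≡⟨ cong (_+ g e) eq ⟩
      ι (suc j) * g e + g e         ≡⟨ cong (λ x → ι (suc j) * g e + x) (ι-1-* (g e)) ⟨
      ι (suc j) * g e + ι 1 * g e   ≡⟨ ℚ.*-distribʳ-+ (g e) (ι (suc j)) (ι 1) ⟨
      (ι (suc j) + ι 1) * g e       ≡⟨ cong (_* g e) (trans (ℚ.+-comm (ι (suc j)) (ι 1)) (sym (ι-+ 1 (suc j)))) ⟩
      ι (suc (suc j)) * g e         ∎
    uncut′ : ∀ i → t ℕ.∸ j ℕ.≤ i → i ℕ.< suc t → e ∉ π i
    uncut′ i lo hi with ℕ.m<1+n⇒m<n∨m≡n hi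
    ... | inj₁ i<t  = uncut i lo i<t
    ... | inj₂ refl = e∉

  module _ (G : ℕ) (frequent : ∀ t → ∃ λ d → d ℕ.< G × e ∈ π (t ℕ.+ d)) where

    height≤ : ∀ t → height t ≤ ι G * g e
    height≤ t with j , j≤t , eq , uncut ← height-age t | j ℕ.<? G
    ... | yes j<G = ℚ.≤-trans (ℚ.≤-reflexive eq) (ℚ.*-monoʳ-≤-nonNeg (g e) {{ℚ.nonNegative (g-nonneg e)}} (ι-mono-≤ j<G))
    -- An age of at least `G` would mean `G` successive days without a cut.
    ... | no j≮G with d , d<G , e∈ ← frequent (t ℕ.∸ j) = contradiction e∈
      (uncut _ (ℕ.m≤m+n _ d) (subst (t ℕ.∸ j ℕ.+ d ℕ.<_) (ℕ.m∸n+n≡m j≤t) (ℕ.+-monoʳ-< (t ℕ.∸ j) (ℕ.<-≤-trans d<G (ℕ.≮⇒≥ j≮G)))))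

    height-sup : ∀ m → (∀ t → π (t ℕ.+ suc m) ≡ π t) → ∃ λ t → IsSup height (height t)
    -- Heights need not be periodic before the first cut, so the period starts on the day after it.
    height-sup m π-periodic with d , _ , e∈ ← frequent 0 = eventually-periodic-sup height (suc d) m periodic
      where
      periodic : ∀ k → height (suc d ℕ.+ k ℕ.+ suc m) ≡ height (suc d ℕ.+ k)
      periodic zero rewrite ℕ.+-identityʳ d =
        trans (height-cut (subst (e ∈_) (sym (π-periodic d)) e∈)) (sym (height-cut e∈))
      periodic (suc k) rewrite ℕ.+-suc d k | π-periodic (suc (d ℕ.+ k)) | periodic k = refl

    bounded-sup : ∀ m → (∀ t → π (t ℕ.+ suc m) ≡ π t) → ∀ {B} → ι G * g e < B →
                  ∃ λ x → IsSup height x × x < B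
    bounded-sup m π-periodic Gg<B =
      let t , isSup = height-sup m π-periodic in height t , isSup , ℚ.≤-<-trans (height≤ t) Gg<B

  height-zero : g e ≡ 0ℚ → ∀ t → height t ≡ 0ℚ
  height-zero g≡0 zero = g≡0
  height-zero g≡0 (suc t) with does (e ∈? π t)
  ... | true  = g≡0
  ... | false = cong₂ _+_ (height-zero g≡0 t) g≡0

-- `max<v⁺` speaks of the strict order derived from `≤`, a pair of `≤` and `≢`; `split` and `join`
-- translate.
max-tabulate< : ∀ {n} {f : Fin n → ℚ} {x B} → x < B → (∀ i → f i < B) → max x (List.tabulate f) < B
max-tabulate< x<B f<B = join (max<v⁺ (split x<B) (All.tabulate⁺ (split ∘ f<B)))
  where
  split : ∀ {x y} → x < y → x ≤ y × x ≢ y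
  split x<y = ℚ.<⇒≤ x<y , ℚ.<⇒≢ x<y
  join : ∀ {x y} → x ≤ y × x ≢ y → x < y
  join (x≤y , x≢y) = ℚ.≰⇒> λ y≤x → x≢y (ℚ.≤-antisym x≤y y≤x)

0<2 : 0ℚ < + 2 / 1
0<2 = subst₂ _<_ ι-0 ι-2 (ι-mono-< (s≤s z≤n))

-- The rotating schedule.

module RotatingSchedule {n : ℕ} (C : CBGT n) (m Q b : ℕ) (0<Q : 0 ℕ.< Q) (N≡ : suc m ≡ Q ℕ.* fib (suc (suc b)))
  (c : Fin n → ℕ) (Ng≡c : ∀ e → ι (suc m) * CBGT.g C e ≡ ι (c e))
  (c≤N : ∀ e → c e ℕ.≤ suc m) (c-large : ∀ e → c e ≡ 0 ⊎ Q ℕ.+ Q ℕ.≤ c e) (a : Fin n → ℕ)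
  where
  open CBGT C

  s : ℕ
  s = Q ℕ.* fib b

  open Rotation m s using (Hit; frequent-hits)
  open Hit

  Frequent : Fin n → Set
  Frequent e = ∃₂ λ t₀ G → c e ℕ.* G ℕ.< 2 ℕ.* suc m × (∀ k → ∃ λ d → d ℕ.< G × Hit (a e) (c e) (t₀ ℕ.+ k ℕ.+ d))

  frequent : ∀ e → c e ≡ 0 ⊎ Frequent e
  frequent e = ⊎.map₂ (λ 2Q≤c → frequent-hits Q b 0<Q refl N≡ (a e) (c e) 2Q≤c (c≤N e)) (c-large e)

  first : ∀ {e} → c e ≡ 0 ⊎ Frequent e → ℕ
  first (inj₁ _)        = 0
  first (inj₂ (t₀ , _)) = t₀

  -- The rotation runs for K days before the schedule starts, so that the return
  -- times also bound the wait until the first cut.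
  K : ℕ
  K = ℕ∑.sum (λ e → first (frequent e))

  cut? : ∀ t e → Dec (((K ℕ.+ t) ℕ.* s ℕ.+ a e) % suc m ℕ.< c e)
  cut? t e = ((K ℕ.+ t) ℕ.* s ℕ.+ a e) % suc m ℕ.<? c e

  π : Schedule n
  π t = ⟪ cut? t ⟫

  π-periodic : ∀ t → π (t ℕ.+ suc m) ≡ π t
  π-periodic t = tabulate-cong λ e → cong (λ x → does (x ℕ.<? c e)) (trans
    (cong (_% suc m) (regroup K t (suc m) s (a e)))
    ([m+kn]%n≡m%n ((K ℕ.+ t) ℕ.* s ℕ.+ a e) s (suc m)))
    where
    open +-*-Solver
    regroup : ∀ K t N s a → (K ℕ.+ (t ℕ.+ N)) ℕ.* s ℕ.+ a ≡ (K ℕ.+ t) ℕ.* s ℕ.+ a ℕ.+ s ℕ.* N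
    regroup = solve 5 (λ K t N s a → (K :+ (t :+ N)) :* s :+ a := (K :+ t) :* s :+ a :+ s :* N) refl

  sup : ∀ e → ∃ λ x → IsSup (λ t → heightOn C π t e) x × x < + 2 / 1
  sup e = go (frequent e) (term≤sum (λ e → first (frequent e)) e)
    where
    open Heights C π e
    go : (r : c e ≡ 0 ⊎ Frequent e) → first r ℕ.≤ K → ∃ λ x → IsSup height x × x < + 2 / 1
    -- A bamboo with an empty arc is never cut, but it does not grow either.
    go (inj₁ c≡0) _ = 0ℚ , ((λ t → ℚ.≤-reflexive (height-zero g≡0 t)) , λ b f≤b → subst (_≤ b) (height-zero g≡0 0) (f≤b 0)) ,
      0<2
      where
      g≡0 : g e ≡ 0ℚ
      g≡0 = ℚ.≤-antisym (ℚ.*-cancelˡ-≤-pos (ι (suc m)) {{ℚ.positive (subst (_< ι (suc m)) ι-0 (ι-mono-< (s≤s z≤n)))}} (ℚ.≤-reflexive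
        (trans (Ng≡c e) (trans (trans (cong ι c≡0) ι-0) (sym (ℚ.*-zeroʳ (ι (suc m)))))))) (g-nonneg e)
    go (inj₂ (t₀ , G , cG<2N , hits)) t₀≤K = bounded-sup G cuts m π-periodic (subst (ι G * g e <_) ι-2 Gg<2)
      where
      cuts : ∀ t → ∃ λ d → d ℕ.< G × e ∈ π (t ℕ.+ d)
      cuts t =
        -- Day `t` of the schedule is day `K + t` of the rotation, which is not before `t₀`.
        let d , d<G , hit = hits (K ℕ.∸ t₀ ℕ.+ t)
        in d , d<G , ∈⟪⟫⁺ (cut? (t ℕ.+ d)) (inside-arc (subst (Hit (a e) (c e)) (time d) hit))
        where
        time : ∀ d → t₀ ℕ.+ (K ℕ.∸ t₀ ℕ.+ t) ℕ.+ d ≡ K ℕ.+ (t ℕ.+ d)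
        time d = trans (cong (ℕ._+ d) (trans (sym (ℕ.+-assoc t₀ (K ℕ.∸ t₀) t)) (cong (ℕ._+ t) (ℕ.m+[n∸m]≡n t₀≤K)))) (ℕ.+-assoc K t d)
      Gg<2 : ι G * g e < ι 2
      Gg<2 = ℚ.*-cancelˡ-<-nonNeg (ι (suc m)) (begin-strict
        ι (suc m) * (ι G * g e)   ≡⟨ cong (ι (suc m) *_) (ℚ.*-comm (ι G) (g e)) ⟩
        ι (suc m) * (g e * ι G)   ≡⟨ ℚ.*-assoc (ι (suc m)) (g e) (ι G) ⟨
        ι (suc m) * g e * ι G     ≡⟨ cong (_* ι G) (Ng≡c e) ⟩
        ι (c e) * ι G             ≡⟨ ι-* (c e) G ⟨
        ι (c e ℕ.* G)             <⟨ ι-mono-< cG<2N ⟩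
        ι (2 ℕ.* suc m)           ≡⟨ cong ι (ℕ.*-comm 2 (suc m)) ⟩
        ι (suc m ℕ.* 2)           ≡⟨ ι-* (suc m) 2 ⟩
        ι (suc m) * ι 2           ∎)
        where open ℚ.≤-Reasoning

  trimmed : (∀ θ → ℐ ⟪ (λ e → (θ ℕ.+ a e) % suc m ℕ.<? c e) ⟫) →
            ∃ λ (π : Schedule n) → Valid C π × ∃ λ h → HasHeight C π h × h < + 2 / 1
  trimmed independent = π , (λ t → independent ((K ℕ.+ t) ℕ.* s)) , max 0ℚ (List.tabulate (proj₁ ∘ sup)) ,
    (proj₁ ∘ sup , proj₁ ∘ proj₂ ∘ sup , refl) , max-tabulate< 0<2 (λ e → proj₂ (proj₂ (sup e)))

theorem3p1 : (n : ℕ) (C : CBGT n) → IsMatroid (CBGT.ℐ C) →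
    ∃ λ (π : Schedule n) → Valid C π × (∃ λ (h : ℚ) → HasHeight C π h × h < + 2 / 1)
theorem3p1 n C M = RotatingSchedule.trimmed C m Q b 0<Q N≡ c Ng≡c c≤N c-large (proj₁ arcs) (proj₂ arcs)
  where
  open CBGT C
  Q,p = common-denominator g g-nonneg
  Q = proj₁ Q,p
  p : Fin n → ℕ
  p = proj₁ (proj₂ Q,p)
  0<Q : 0 ℕ.< Q
  0<Q = proj₁ (proj₂ (proj₂ Q,p))
  -- Large enough that `F`, and with it every nonzero `c e`, is at least `2 Q`; this lets the search
  -- end.
  b = Q ℕ.+ Q
  F = fib (suc (suc b))
  m = ℕ.pred (Q ℕ.* F)
  N≡ : suc m ≡ Q ℕ.* F
  N≡ = ℕ.suc-pred (Q ℕ.* F) {{ℕ.>-nonZero (ℕ.*-mono-< 0<Q (1≤fib (suc (suc b))))}}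
  c : Fin n → ℕ
  c e = F ℕ.* p e
  Ng≡c : ∀ e → ι (suc m) * g e ≡ ι (c e)
  Ng≡c e = begin
    ι (suc m) * g e       ≡⟨ cong (λ x → ι x * g e) (trans N≡ (ℕ.*-comm Q F)) ⟩
    ι (F ℕ.* Q) * g e     ≡⟨ cong (_* g e) (ι-* F Q) ⟩
    ι F * ι Q * g e       ≡⟨ ℚ.*-assoc (ι F) (ι Q) (g e) ⟩
    ι F * (ι Q * g e)     ≡⟨ cong (ι F *_) (proj₂ (proj₂ (proj₂ Q,p)) e) ⟩
    ι F * ι (p e)         ≡⟨ ι-* F (p e) ⟨
    ι (c e)               ∎
    where open ≡-Reasoning

  open Closure ℐ? M
  sparse : ∀ {A J} → ℐ J → (∀ {e} → e ∈ A → Spans J e) → ℕ∑.sum (λ e → 𝟙 (e ∈? A) ℕ.* c e) ℕ.≤ suc m ℕ.* ∣ J ∣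
  sparse = g-sparse C M c Ng≡c

  -- Sparsity of a singleton, whose rank is at most 1.
  c≤N : ∀ e → c e ℕ.≤ suc m
  c≤N e = begin
    c e                                          ≡⟨ ℕ.*-identityˡ (c e) ⟨
    1 ℕ.* c e                                    ≡⟨ cong (ℕ._* c e) (𝟙-true (e ∈? ⁅ e ⁆) (x∈⁅x⁆ e)) ⟨
    𝟙 (e ∈? ⁅ e ⁆) ℕ.* c e                       ≤⟨ term≤sum (λ x → 𝟙 (x ∈? ⁅ e ⁆) ℕ.* c x) e ⟩
    ℕ∑.sum (λ x → 𝟙 (x ∈? ⁅ e ⁆) ℕ.* c x)        ≤⟨ sparse (indep B) (spans B) ⟩
    suc m ℕ.* ∣ set B ∣                          ≤⟨ ℕ.*-monoʳ-≤ (suc m) (p⊆q⇒∣p∣≤∣q∣ (set⊆ B)) ⟩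
    suc m ℕ.* ∣ ⁅ e ⁆ ∣                          ≡⟨ cong (suc m ℕ.*_) (∣⁅x⁆∣≡1 e) ⟩
    suc m ℕ.* 1                                  ≡⟨ ℕ.*-identityʳ (suc m) ⟩
    suc m                                        ∎
    where
    open ℕ.≤-Reasoning
    B = basis ⁅ e ⁆

  arcs = Arcs.independent-arcs ℐ? M m c c≤N sparse

  c-large : ∀ e → c e ≡ 0 ⊎ Q ℕ.+ Q ℕ.≤ c e
  c-large e with p e
  ... | zero  = inj₁ (ℕ.*-zeroʳ F)
  ... | suc x = inj₂ (ℕ.≤-trans (ℕ.≤-trans (ℕ.m≤n+m b 2) (n≤fib (2 ℕ.+ b))) (ℕ.m≤m*n F (suc x)))
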